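{- For all integers $k \ge 0$ and $\ell \ge 3$, there exists an integer $f(k,\ell) \ge 0$ such that every tournament $T$ with $\overrightarrow{\chi}(T) \ge f(k,\ell)$ contains a subdigraph $H \subseteq T$ with $\overrightarrow{\chi}(H) > k$ and $\overrightarrow{\mathrm{girth}}(H) > \ell$.
   Context: All graphs and digraphs are finite. A tournament is a digraph with exactly one arc between every pair of distinct vertices (and no loops). A subdigraph of $T$ is any digraph obtained by taking a subset of the vertices and a subset of the arcs among them (not necessarily induced). The dichromatic number $\overrightarrow{\chi}(D)$ of a digraph $D$ is the least integer $k \ge 0$ such that the vertices of $D$ can be partitioned into $k$ sets each inducing an acyclic subdigraph (no directed cycle). The digirth $\overrightarrow{\mathrm{girth}}(D)$ is the minimum size (number of vertices) of a directed cycle in $D$, with value $+\infty$ if $D$ has no directed cycle. -}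

module Defs where

open import Level using (Level; 0ℓ)
open import Data.Nat.Base using (ℕ; zero; suc; _≤_; _<_; z≤n; s≤s; NonZero)
open import Data.Nat.DivMod using (_mod_)
open import Data.Nat.Properties using (anyUpTo?)
open import Data.Fin.Base using (Fin; toℕ)
open import Data.Fin.Properties using (any?; all?; _≟_; injective⇒≤)
open import Data.Fin.Subset using (Subset; _∈_; _⊆_; _∩_; ⁅_⁆)
open import Data.Fin.Subset.Properties
  using (_∈?_; _⊆?_; anySubset?; x∈p∩q⁺; p∩q⊆p; p∩q⊆q; x∈⁅x⁆; x∈⁅y⁆⇒x≡y)
open import Data.Product.Base using (∃; _×_; _,_; proj₁; proj₂)
open import Data.Product using (∃!)
open import Data.Sum.Base using (_⊎_)
open import Data.Vec.Base using (Vec; []; _∷_; lookup; tabulate)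
open import Data.Vec.Properties using (lookup∘tabulate)
open import Function.Base using (_∘_)
open import Function.Definitions using (Injective)
open import Relation.Binary.Core using (Rel)
import Relation.Binary.Definitions as B
open import Relation.Binary.PropositionalEquality
  using (_≡_; _≢_; _≗_; sym; trans; subst; subst₂)
open import Relation.Nullary using (Dec; yes; no; ¬_; ¬?; contradiction)
open import Relation.Nullary.Construct.Add.Supremum using (_⁺; [_]; ⊤⁺)
open import Relation.Nullary.Decidable using (map′; _×-dec_; _→-dec_)
import Relation.Binary.Construct.Add.Supremum.Strict as Strict
open import Relation.Unary using (Pred; Decidable)

open Strict _<_ public using (_<⁺_)

private variable
  p : Level
  k m n : ℕ

-- The vertex set is an arbitrary subset of the ambient set Fin n, so that
-- a subdigraph can literally have a subset of the vertices.  A loop would be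
-- a directed cycle of size 1 and would leave the dichromatic number undefined.
-- Pairs of opposite arcs are allowed.
record Digraph (n : ℕ) : Set₁ where
  infix 4 _⟶_ _⟶?_
  field
    V        : Subset n
    _⟶_      : Rel (Fin n) 0ℓ
    _⟶?_     : B.Decidable _⟶_
    ends     : ∀ {u v} → u ⟶ v → u ∈ V × v ∈ V
    loopless : ∀ {v} → ¬ (v ⟶ v)

open Digraph public using (V)

record IsTournament (T : Digraph n) : Set where
  open Digraph T using (_⟶_)
  field
    exactlyOne : ∀ {u v} → u ∈ V T → v ∈ V T → u ≢ v →
                 (u ⟶ v × ¬ (v ⟶ u)) ⊎ (¬ (u ⟶ v) × v ⟶ u)

infix 4 _⊑_

record _⊑_ (H D : Digraph n) : Set where
  private
    module H = Digraph H
    module D = Digraph D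
  field
    vertices : V H ⊆ V D
    arcs     : ∀ {u v} → u H.⟶ v → u D.⟶ v

induced : Digraph n → Subset n → Digraph n
induced D S = record
  { V        = V D ∩ S
  ; _⟶_      = λ u v → (u ∈ S × v ∈ S) × u ⟶ v
  ; _⟶?_     = λ u v → ((u ∈? S) ×-dec (v ∈? S)) ×-dec (u ⟶? v)
  ; ends     = λ ((u∈S , v∈S) , uv) →
                 x∈p∩q⁺ (proj₁ (ends uv) , u∈S) , x∈p∩q⁺ (proj₂ (ends uv) , v∈S)
  ; loopless = loopless ∘ proj₂
  }
  where open Digraph D using (_⟶_; _⟶?_; ends; loopless)

-- A directed cycle of size m: distinct vertices c 0 , … , c (m - 1), m ≥ 1,
-- with arcs c i ⟶ c (i + 1), indices taken modulo m.
record IsDirectedCycle (D : Digraph n) (c : Fin m → Fin n) : Set where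
  open Digraph D using (_⟶_)
  field
    {{nonEmpty}} : NonZero m
    distinct     : Injective _≡_ _≡_ c
    consecutive  : ∀ i → c i ⟶ c (suc (toℕ i) mod m)

HasDirectedCycle : Digraph n → ℕ → Set
HasDirectedCycle {n} D m = ∃ λ (c : Fin m → Fin n) → IsDirectedCycle D c

Acyclic : Digraph n → Set
Acyclic D = ∀ m → ¬ HasDirectedCycle D m

record IsAcyclicPartition (D : Digraph n) (P : Fin k → Subset n) : Set where
  field
    parts   : ∀ i → P i ⊆ V D
    covers  : ∀ {v} → v ∈ V D → ∃! _≡_ λ i → v ∈ P i
    acyclic : ∀ i → Acyclic (induced D (P i))

-- Parts may be empty; this does not affect the least possible k.
Dicolourable : Digraph n → ℕ → Set
Dicolourable {n} D k = ∃ λ (P : Fin k → Subset n) → IsAcyclicPartition D P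

IsLeast : Pred ℕ p → Pred ℕ p
IsLeast P k = P k × (∀ j → P j → k ≤ j)

IsDichromaticNumber : Digraph n → ℕ → Set
IsDichromaticNumber D = IsLeast (Dicolourable D)

IsDigirth : Digraph n → ℕ ⁺ → Set
IsDigirth D [ g ] = IsLeast (HasDirectedCycle D) g
IsDigirth D ⊤⁺    = Acyclic D

least : {P : Pred ℕ p} → Decidable P → ∀ k → P k → ∃ (IsLeast P)
least P? zero    Pk = zero , Pk , λ _ _ → z≤n
least {P = P} P? (suc k) Pk with P? zero
... | yes P0 = zero , P0 , λ _ _ → z≤n
... | no ¬P0 with least (P? ∘ suc) k Pk
...   | l , Pl , min = suc l , Pl , λ
  { zero    P0 → contradiction P0 ¬P0
  ; (suc j) Pj → s≤s (min j Pj)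
  }

anyVec? : {A : Set} → (∀ {P : Pred A 0ℓ} → Decidable P → Dec (∃ P)) →
          ∀ m {P : Pred (Vec A m) 0ℓ} → Decidable P → Dec (∃ P)
anyVec? anyA? zero    P? = map′ ([] ,_) (λ { ([] , p) → p }) (P? [])
anyVec? anyA? (suc m) P? =
  map′ (λ (x , xs , p) → x ∷ xs , p) (λ { (x ∷ xs , p) → x , xs , p })
       (anyA? λ x → anyVec? anyA? m (P? ∘ (x ∷_)))

anyVector? : {A : Set} → (∀ {P : Pred A 0ℓ} → Decidable P → Dec (∃ P)) →
             ∀ m {P : Pred (Fin m → A) 0ℓ} →
             (∀ {f g} → f ≗ g → P f → P g) → Decidable P → Dec (∃ P)
anyVector? anyA? m resp P? =
  map′ (λ (xs , p) → lookup xs , p)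
       (λ (f , p) → tabulate f , resp (λ i → sym (lookup∘tabulate f i)) p)
       (anyVec? anyA? m (P? ∘ lookup))

module _ (D : Digraph n) where
  open Digraph D using (_⟶_; _⟶?_)

  isDirectedCycle-resp : {c d : Fin m → Fin n} → c ≗ d →
                         IsDirectedCycle D c → IsDirectedCycle D d
  isDirectedCycle-resp c≗d cyc = record
    { distinct    = λ {i} {j} di≡dj →
                      distinct (trans (c≗d i) (trans di≡dj (sym (c≗d j))))
    ; consecutive = λ i → subst₂ _⟶_ (c≗d i) (c≗d _) (consecutive i)
    }
    where open IsDirectedCycle cyc

  size≢0 : {c : Fin 0 → Fin n} → ¬ IsDirectedCycle D c
  size≢0 record { nonEmpty = () }

  isDirectedCycle? : Decidable (IsDirectedCycle {m = m} D)
  isDirectedCycle? {zero}  c = no size≢0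
  isDirectedCycle? {suc m} c =
    map′ (λ (inj , arcs) → record { distinct = inj _ _ ; consecutive = arcs })
         (λ cyc → (λ _ _ → IsDirectedCycle.distinct cyc) , IsDirectedCycle.consecutive cyc)
         ((all? λ i → all? λ j → (c i ≟ c j) →-dec (i ≟ j))
          ×-dec all? λ i → c i ⟶? c (suc (toℕ i) mod suc m))

  hasDirectedCycle? : Decidable (HasDirectedCycle D)
  hasDirectedCycle? m = anyVector? any? m isDirectedCycle-resp isDirectedCycle?

  hasDirectedCycle⇒≤ : HasDirectedCycle D m → m ≤ n
  hasDirectedCycle⇒≤ (_ , cyc) = injective⇒≤ (IsDirectedCycle.distinct cyc)

  cyclic? : Dec (∃ (HasDirectedCycle D))
  cyclic? = map′ (λ (m , _ , cyc) → m , cyc)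
                 (λ (m , cyc) → m , s≤s (hasDirectedCycle⇒≤ cyc) , cyc)
                 (anyUpTo? hasDirectedCycle? (suc n))

  acyclic? : Dec (Acyclic D)
  acyclic? = map′ (λ ¬cyc m cyc → ¬cyc (m , cyc)) (λ acy (m , cyc) → acy m cyc) (¬? cyclic?)

module _ (D : Digraph n) where
  open Digraph D using (_⟶_; loopless)

  isAcyclicPartition-resp : {P Q : Fin k → Subset n} → P ≗ Q →
                            IsAcyclicPartition D P → IsAcyclicPartition D Q
  isAcyclicPartition-resp P≗Q part = record
    { parts   = λ i → subst (_⊆ V D) (P≗Q i) (parts i)
    ; covers  = λ v∈V → let i , v∈Pi , uniq = covers v∈V in
                  i , subst (_ ∈_) (P≗Q i) v∈Pi ,
                  λ {j} v∈Qj → uniq (subst (_ ∈_) (sym (P≗Q j)) v∈Qj)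
    ; acyclic = λ i → subst (Acyclic ∘ induced D) (P≗Q i) (acyclic i)
    }
    where open IsAcyclicPartition part

  isAcyclicPartition? : Decidable (IsAcyclicPartition {k = k} D)
  isAcyclicPartition? P =
    map′ (λ (parts , covers , acyclic) → record
           { parts   = parts
           ; covers  = λ v∈V → let i , v∈Pi , uniq = covers _ v∈V in
                         i , v∈Pi , λ {j} → uniq j
           ; acyclic = acyclic
           })
         (λ part → let open IsAcyclicPartition part in
           parts ,
           (λ v v∈V → let i , v∈Pi , uniq = covers v∈V in i , v∈Pi , λ j → uniq {j}) ,
           acyclic)
         (all? (λ i → P i ⊆? V D)
          ×-dec all? (λ v → (v ∈? V D) →-dec
                  any? λ i → (v ∈? P i) ×-dec all? λ j → (v ∈? P j) →-dec (i ≟ j))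
          ×-dec all? (λ i → acyclic? (induced D (P i))))

  dicolourable? : Decidable (Dicolourable D)
  dicolourable? k = anyVector? anySubset? k isAcyclicPartition-resp isAcyclicPartition?

  dicolourable-order : Dicolourable D n
  dicolourable-order = (λ i → V D ∩ ⁅ i ⁆) , record
    { parts   = λ i → p∩q⊆p (V D) ⁅ i ⁆
    ; covers  = λ {v} v∈V → v , x∈p∩q⁺ (v∈V , x∈⁅x⁆ v) , λ v∈Pj → singleton v∈Pj
    ; acyclic = λ { i zero    (_ , cyc) → size≢0 (induced D _) cyc
                  ; i (suc m) (_ , cyc) → noCycle i (IsDirectedCycle.consecutive cyc Fin.zero)
                  }
    }
    where
    singleton : ∀ {v i} → v ∈ V D ∩ ⁅ i ⁆ → v ≡ i
    singleton {i = i} v∈ = x∈⁅y⁆⇒x≡y i (p∩q⊆q (V D) ⁅ i ⁆ v∈)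

    noCycle : ∀ i {u v} → ¬ ((u ∈ V D ∩ ⁅ i ⁆ × v ∈ V D ∩ ⁅ i ⁆) × u ⟶ v)
    noCycle i ((u∈ , v∈) , uv) = loopless (subst₂ _⟶_ (singleton u∈) (singleton v∈) uv)

opaque
  dichromaticNumber : (D : Digraph n) → ∃ (IsDichromaticNumber D)
  dichromaticNumber {n} D = least (dicolourable? D) n (dicolourable-order D)

  digirth : (D : Digraph n) → ∃ (IsDigirth D)
  digirth D with cyclic? D
  ... | yes (m , cyc) = let g , isLeast = least (hasDirectedCycle? D) m cyc in [ g ] , isLeast
  ... | no ¬cyc       = ⊤⁺ , λ m cyc → ¬cyc (m , cyc)

χ⃗ : Digraph n → ℕ
χ⃗ D = proj₁ (dichromaticNumber D)

girth⃗ : Digraph n → ℕ ⁺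
girth⃗ D = proj₁ (digirth D)

{-# OPTIONS --safe #-}

-- Fix ℓ, and let an (a , b)-cover of a subdigraph R of a tournament T be a covering of the
-- vertices by a sets that are acyclic in R and b sets that are acyclic in T.  By induction
-- on a, then on b: if every subdigraph of digirth > ℓ has an (a , b)-cover, then the
-- dichromatic number of T is bounded.  The theorem is the case b = 0.
--
-- By induction every large vertex set (one of large dichromatic number) carries a digraph
-- of large digirth such that in each (a , b)-cover all a classes of the first kind are large
-- and all b classes of the second kind occur.  Place such sets on levels and add the arcs
-- climbing one level or dropping at least ℓ levels: the digirth stays > ℓ.  If no large parts
-- of A and B are complete from A to B, nor any from B to A, then alternating pieces of A and
-- B around a long cycle of levels contradicts coverability.  So all large sets contain long
-- chains P₀ ⇒ P₁ ⇒ ⋯ of large sets; these show that no large A ⊆ N⁺(v) is complete to a large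
-- B ⊆ N⁻(v), and hence that of N⁺(u) ∩ N⁻(v) and N⁺(v) ∩ N⁻(u) one is always small.  The
-- vertices can therefore be ordered so that all neighbourhoods along backward arcs are small.
-- Use consecutive blocks of this order as levels: within a class, a backward arc over many
-- blocks would be closed to a cycle by a path through the blocks, so all classes are small.
module Submission where

open import Defs
open import Data.Nat.Base using (ℕ; _≤_; _<_)
open import Data.Product.Base using (Σ-syntax; _×_)
open import Relation.Nullary.Construct.Add.Supremum using ([_])

open import Level using (Level; 0ℓ)
open import Data.Bool.Base using (Bool; true; false; not)
import Data.Bool.Properties as Bool
open import Data.Empty using (⊥)
open import Data.Fin.Base using (Fin; toℕ; fromℕ<; splitAt; _↑ˡ_; _↑ʳ_; punchIn; punchOut)
  renaming (zero to fzero; suc to fsuc)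
open import Data.Fin.Properties
  using (any?; _≟_; toℕ<n; toℕ-fromℕ<; toℕ-injective; fromℕ<-toℕ; pigeonhole; splitAt-↑ˡ; splitAt-↑ʳ;
         punchIn-punchOut)
open import Data.Fin.Subset using (Subset; _∈_)
open import Data.Fin.Subset.Properties using (_∈?_)
open import Data.Nat.Base using (zero; suc; _+_; _*_; _∸_; z≤n; s≤s; z<s; s≤s⁻¹)
open import Data.Nat.DivMod using (_%_; _/_; _mod_; m≡m%n+[m/n]*n; m%n<n; m<n⇒m%n≡m; n%n≡0)
open import Data.Nat.Properties hiding (_≟_)
import Data.Nat.Properties as ℕ
open import Data.Product using (∃!)
open import Data.Product.Base using (∃; ∃-syntax; _,_; proj₁; proj₂; swap)
open import Data.Sum.Base using (_⊎_; inj₁; inj₂; [_,_]′)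
open import Data.Vec.Base using (Vec; lookup; tabulate)
open import Data.Vec.Properties using (lookup∘tabulate; lookup⇒[]=; []=⇒lookup)
open import Function.Base using (_∘_; id; case_of_)
import Relation.Binary.Construct.Add.Supremum.Strict as Strict
open import Relation.Binary.Core using (Rel)
open import Relation.Binary.Definitions using (tri<; tri≈; tri>)
open import Relation.Binary.PropositionalEquality
  using (_≡_; _≢_; refl; sym; trans; cong; subst; subst₂)
open import Relation.Nullary using (Dec; does; yes; no; ¬_; contradiction)
open import Relation.Nullary.Construct.Add.Supremum using (⊤⁺)
open import Relation.Nullary.Decidable using (decidable-stable; dec-true; ¬¬-excluded-middle; _×-dec_)
open import Relation.Unary using (Pred; Decidable; _∩_; _⊆_) renaming (_∪_ to _⋃_)

open Strict _<_ using ([_]; [_]<⊤⁺; <⁺-dec)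

private variable
  p q : Level
  k l m n : ℕ

-- Classical reasoning is carried out with goal ⊥, where a doubly negated
-- statement may be used as if it held.
_>>=_ : {A : Set p} → ¬ ¬ A → (A → ⊥) → ⊥
x >>= f = contradiction f x

em : (A : Set p) → ¬ ¬ Dec A
em A = ¬¬-excluded-middle

¬¬-all : ∀ n {P : Fin n → Set p} → (∀ i → ¬ ¬ P i) → ¬ ¬ (∀ i → P i)
¬¬-all zero    h κ = κ λ ()
¬¬-all (suc n) h κ = do
  x ← h fzero
  f ← ¬¬-all n (h ∘ fsuc)
  κ λ { fzero → x ; (fsuc i) → f i }

-- The choice function is total on `ℕ`, so that levels can be indexed by numbers; from `m` on it
-- takes the default value `a`.
¬¬-choice : ∀ m {A : Set p} {P : ℕ → A → Set q} → A → (∀ k → k < m → ¬ ¬ ∃ (P k)) →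
            ¬ ¬ (Σ[ f ∈ (ℕ → A) ] ∀ k → k < m → P k (f k))
¬¬-choice m {A} {P} a h κ = do
  g ← ¬¬-all m (λ i → h (toℕ i) (toℕ<n i))
  κ (at g , holds g)
  where
  at : (∀ i → ∃ (P (toℕ {m} i))) → ℕ → A
  at g k with k ℕ.<? m
  ... | yes k<m = proj₁ (g (fromℕ< k<m))
  ... | no  _   = a

  holds : ∀ g k → k < m → P k (at g k)
  holds g k k<m with k ℕ.<? m
  ... | yes k<m′ = subst (λ j → P j (proj₁ (g (fromℕ< k<m′)))) (toℕ-fromℕ< k<m′) (proj₂ (g (fromℕ< k<m′)))
  ... | no  k≮m  = contradiction k<m k≮m

-- Walks

infixr 5 _∷_

data Walk {V : Set} (Q : V → V → Set q) : ℕ → V → V → Set q where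
  []  : ∀ {u} → Walk Q 0 u u
  _∷_ : ∀ {u v w} → Q u v → Walk Q k v w → Walk Q (suc k) u w

module _ {V : Set} {Q : V → V → Set q} where

  infixr 5 _∷ʳ_

  _∷ʳ_ : ∀ {u v w} → Walk Q k u v → Q v w → Walk Q (suc k) u w
  []      ∷ʳ r = r ∷ []
  (x ∷ w) ∷ʳ r = x ∷ (w ∷ʳ r)

  mapWalk : ∀ {Q′ : V → V → Set p} {u v} → (∀ {x y} → Q x y → Q′ x y) → Walk Q k u v → Walk Q′ k u v
  mapWalk f []      = []
  mapWalk f (x ∷ w) = f x ∷ mapWalk f w

  at : ∀ {u v} → Walk Q k u v → ℕ → V
  at {u = u} []      _       = u
  at {u = u} (x ∷ w) zero    = u
  at         (x ∷ w) (suc i) = at w i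

  at-zero : ∀ {u v} (w : Walk Q k u v) → at w 0 ≡ u
  at-zero []      = refl
  at-zero (x ∷ w) = refl

  at-end : ∀ {u v} (w : Walk Q k u v) → at w k ≡ v
  at-end []      = refl
  at-end (x ∷ w) = at-end w

  step : ∀ {u v} (w : Walk Q k u v) {i} → i < k → Q (at w i) (at w (suc i))
  step (x ∷ w) {zero}  i<k = subst (Q _) (sym (at-zero w)) x
  step (x ∷ w) {suc i} i<k = step w (s≤s⁻¹ i<k)

  tabulateWalk : ∀ (c : ℕ → V) d i → (∀ j → i ≤ j → j < i + d → Q (c j) (c (suc j))) →
                 Walk Q d (c i) (c (i + d))
  tabulateWalk c zero    i h = subst (λ j → Walk Q 0 (c i) (c j)) (sym (+-identityʳ i)) []
  tabulateWalk c (suc d) i h =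
    h i ≤-refl (m<m+n i z<s) ∷
    subst (λ j → Walk Q d (c (suc i)) (c j)) (sym (+-suc i d))
      (tabulateWalk c d (suc i) λ j i<j j< → h j (<⇒≤ i<j) (subst (j <_) (sym (+-suc i d)) j<))

  closedSubwalk : ∀ {u v} (w : Walk Q k u v) {i j} → i < j → j ≤ k → at w i ≡ at w j →
                  Walk Q (suc (j ∸ suc i)) (at w i) (at w i)
  closedSubwalk w {i} {j} i<j j≤k eq =
    subst (λ x → Walk Q _ (at w i) x) (trans (cong (at w) i+d≡j) (sym eq))
      (tabulateWalk (at w) (suc (j ∸ suc i)) i λ l _ l< → step w (<-≤-trans (subst (l <_) i+d≡j l<) j≤k))
    where
    i+d≡j : i + suc (j ∸ suc i) ≡ j
    i+d≡j = trans (+-suc i _) (m+[n∸m]≡n i<j)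

-- A walk of length `n` has `n + 1` positions, so the pigeonhole principle yields a repeated vertex.
longWalk⇒closedWalk : ∀ {Q : Fin n → Fin n → Set q} {u v} → Walk Q n u v → ∃[ k ] ∃[ x ] Walk Q (suc k) x x
longWalk⇒closedWalk w =
  let i , j , i<j , eq = pigeonhole ≤-refl (at w ∘ toℕ)
  in  _ , _ , closedSubwalk w i<j (s≤s⁻¹ (toℕ<n j)) eq

infixl 7 _↾_

_↾_ : {V : Set} → Rel V 0ℓ → Pred V 0ℓ → Rel V 0ℓ
(Q ↾ S) u v = S u × S v × Q u v

NoClosedWalk : {V : Set} → (V → V → Set q) → Set q
NoClosedWalk Q = ∀ {k v} → ¬ Walk Q (suc k) v v

noClosedWalk-⊆ : ∀ {V : Set} {Q : V → V → Set p} {Q′ : V → V → Set q} →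
                 (∀ {u v} → Q u v → Q′ u v) → NoClosedWalk Q′ → NoClosedWalk Q
noClosedWalk-⊆ f nc w = nc (mapWalk f w)

module _ {Q : Fin n → Fin n → Set q} (acyclic : NoClosedWalk Q) where

  private
    Ends : ℕ → Fin n → Set q
    Ends k v = ∃[ u ] Walk Q k u v

    module Longest (dec : ∀ v (k : Fin (suc n)) → Dec (Ends (toℕ k) v)) where

      ends? : ∀ k → k ≤ n → ∀ v → Dec (Ends k v)
      ends? k k≤n v = subst (λ j → Dec (Ends j v)) (toℕ-fromℕ< (s≤s k≤n)) (dec v (fromℕ< (s≤s k≤n)))

      longest : ∀ N → N ≤ n → Fin n → ℕ
      longest zero    _   v = 0
      longest (suc N) N<n v with ends? (suc N) N<n v
      ... | yes _ = suc N
      ... | no  _ = longest N (<⇒≤ N<n) v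

      longest-≤ : ∀ N N≤n v → longest N N≤n v ≤ N
      longest-≤ zero    _   v = z≤n
      longest-≤ (suc N) N<n v with ends? (suc N) N<n v
      ... | yes _ = ≤-refl
      ... | no  _ = m≤n⇒m≤1+n (longest-≤ N (<⇒≤ N<n) v)

      longest-ends : ∀ N N≤n v → Ends (longest N N≤n v) v
      longest-ends zero    _   v = v , []
      longest-ends (suc N) N<n v with ends? (suc N) N<n v
      ... | yes e = e
      ... | no  _ = longest-ends N (<⇒≤ N<n) v

      longest-max : ∀ N N≤n v {k} → k ≤ N → Ends k v → k ≤ longest N N≤n v
      longest-max zero    _   v k≤N e = k≤N
      longest-max (suc N) N<n v k≤N e with ends? (suc N) N<n v
      ... | yes _ = k≤N
      ... | no ¬e with m≤n⇒m<n∨m≡n k≤N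
      ...   | inj₁ k<1+N = longest-max N (<⇒≤ N<n) v (s≤s⁻¹ k<1+N) e
      ...   | inj₂ refl  = contradiction e ¬e

      rank : Fin n → ℕ
      rank = longest n ≤-refl

      rank-mono : ∀ {u v} → Q u v → rank u < rank v
      rank-mono {u} {v} uv with longest-ends n ≤-refl u
      ... | x , w with m≤n⇒m<n∨m≡n (longest-≤ n ≤-refl u)
      ...   | inj₁ r<n = longest-max n ≤-refl v r<n (x , w ∷ʳ uv)
      ...   | inj₂ r≡n with longWalk⇒closedWalk (subst (λ j → Walk Q j x u) r≡n w)
      ...     | _ , _ , c = contradiction c acyclic

  -- `pos v` is the length of a longest walk ending at `v`. A walk of length `n` already contains a
  -- closed walk, so it is enough to search among the lengths up to `n`.
  rankFunction : ¬ ¬ (Σ[ pos ∈ (Fin n → ℕ) ] (∀ v → pos v ≤ n) × ∀ {u v} → Q u v → pos u < pos v)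
  rankFunction κ = do
    dec ← ¬¬-all n λ v → ¬¬-all (suc n) λ k → em (Ends (toℕ k) v)
    κ (Longest.rank dec , Longest.longest-≤ dec n ≤-refl , Longest.rank-mono dec)

pick : {A : Set p} {B : Set q} → Dec A → B → B → B
pick (yes _) x y = x
pick (no  _) x y = y

pick-yes : {A : Set p} {B : Set q} (d : Dec A) {x y : B} → A → pick d x y ≡ x
pick-yes (yes _) a = refl
pick-yes (no ¬a) a = contradiction a ¬a

pick-no : {A : Set p} {B : Set q} (d : Dec A) {x y : B} → ¬ A → pick d x y ≡ y
pick-no (yes a) ¬a = contradiction a ¬a
pick-no (no _)  ¬a = refl

even : ℕ → Bool
even zero    = true
even (suc k) = not (even k)

even-double : ∀ k → even (k + k) ≡ true
even-double zero    = refl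
even-double (suc k) = trans (cong (not ∘ even) (+-suc k k)) (trans (Bool.not-involutive (even (k + k))) (even-double k))

-- Vertex sets of small dichromatic number

record Tournament (n : ℕ) : Set₁ where
  infix 4 _⟶_
  field
    _⟶_   : Rel (Fin n) 0ℓ
    asym  : ∀ {u v} → u ⟶ v → ¬ (v ⟶ u)
    total : ∀ {u v} → u ≢ v → u ⟶ v ⊎ v ⟶ u

fibre : {V : Set} → Pred V 0ℓ → (V → ℕ) → ℕ → Pred V 0ℓ
fibre Y f k v = Y v × f v ≡ k

module Smallness {n : ℕ} (T : Tournament n) where
  open Tournament T public

  private variable
    s M : ℕ
    X Y Z : Pred (Fin n) 0ℓ

  irrefl : ∀ {v} → ¬ (v ⟶ v)
  irrefl vv = asym vv vv

  -- Classes may overlap and may reach outside `Y`, and a vertex has a colour only up to double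
  -- negation; thus sets need not be decidable.
  record Colouring (k : ℕ) (Y : Pred (Fin n) 0ℓ) : Set₁ where
    field
      class   : Fin k → Pred (Fin n) 0ℓ
      covers  : ∀ {v} → Y v → ¬ ¬ (∃[ i ] class i v)
      acyclic : ∀ i → NoClosedWalk (_⟶_ ↾ (class i ∩ Y))

  -- Small k Y says that the subtournament on Y has dichromatic number at most k.
  Small : ℕ → Pred (Fin n) 0ℓ → Set₁
  Small k Y = ¬ ¬ Colouring k Y

  small-stable : ¬ ¬ Small k Y → Small k Y
  small-stable h κ = h λ sm → sm κ

  restrictColouring : X ⊆ Y → Colouring k Y → Colouring k X
  restrictColouring X⊆Y c = record
    { class   = class
    ; covers  = covers ∘ X⊆Y
    ; acyclic = λ i → noClosedWalk-⊆ (λ ((a , x) , (b , y) , e) → (a , X⊆Y x) , (b , X⊆Y y) , e) (acyclic i)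
    }
    where open Colouring c

  small-⊆ : X ⊆ Y → Small k Y → Small k X
  small-⊆ X⊆Y sm κ = sm (κ ∘ restrictColouring X⊆Y)

  small-∅ : (∀ {v} → ¬ X v) → Small k X
  small-∅ empty κ = κ record
    { class   = λ _ _ → ⊥
    ; covers  = λ x → contradiction x empty
    ; acyclic = λ { i (((() , _) , _) ∷ _) }
    }

  nonempty : ¬ Small k X → ¬ ¬ (∃[ v ] X v)
  nonempty ¬sm κ = ¬sm (small-∅ λ x → κ (_ , x))

  small-∪ : Small k X → Small l Y → (∀ {v} → Z v → ¬ ¬ (X v ⊎ Y v)) → Small (k + l) Z
  small-∪ {k = k} {X = X} {l = l} {Y = Y} {Z = Z} smX smY split κ = do
    c ← smX
    d ← smY
    let module C = Colouring c
        module D = Colouring d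
        class : Fin k ⊎ Fin l → Pred (Fin n) 0ℓ
        class = [ (λ i → C.class i ∩ X) , (λ j → D.class j ∩ Y) ]′
        acyclic : ∀ i → NoClosedWalk (_⟶_ ↾ (class i ∩ Z))
        acyclic = λ
          { (inj₁ i) → noClosedWalk-⊆ (λ ((a , _) , (b , _) , e) → a , b , e) (C.acyclic i)
          ; (inj₂ j) → noClosedWalk-⊆ (λ ((a , _) , (b , _) , e) → a , b , e) (D.acyclic j)
          }
    κ record
      { class   = class ∘ splitAt k
      ; covers  = λ {v} z κ′ → split z λ
          { (inj₁ x) → C.covers x λ (i , c) →
              κ′ (i ↑ˡ l , subst (λ i → class i v) (sym (splitAt-↑ˡ k i l)) (c , x))
          ; (inj₂ y) → D.covers y λ (j , d) →
              κ′ (k ↑ʳ j , subst (λ i → class i v) (sym (splitAt-↑ʳ k l j)) (d , y))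
          }
      ; acyclic = acyclic ∘ splitAt k
      }

  small-≤ : k ≤ l → Small k X → Small l X
  small-≤ {k} k≤l sm = subst (λ j → Small j _) (m+[n∸m]≡n k≤l)
    (small-∪ sm (small-∅ {X = λ _ → ⊥} λ ()) λ x κ → κ (inj₁ x))

  small-singleton : (∀ {u v} → X u → X v → u ≡ v) → Small 1 X
  small-singleton unique κ = κ record
    { class   = λ _ → _
    ; covers  = λ x κ′ → κ′ (fzero , x)
    ; acyclic = λ { i (((x , _) , (y , _) , e) ∷ _) → irrefl (subst (_⟶ _) (unique x y) e) }
    }

  small-⋃ : ∀ m {X : ℕ → Pred (Fin n) 0ℓ} → (∀ k → k < m → Small s (X k)) →
            (∀ {v} → Y v → ¬ ¬ (∃[ k ] k < m × X k v)) → Small (m * s) Y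
  small-⋃ zero    sm cover = small-∅ λ y → cover y λ { (_ , () , _) }
  small-⋃ (suc m) {X} sm cover = small-∪ (sm m ≤-refl)
    (small-⋃ {Y = λ v → ∃[ k ] k < m × X k v} m {X} (λ k k<m → sm k (m≤n⇒m≤1+n k<m)) λ x κ → κ x)
    λ y κ → cover y λ (k , k<1+m , x) → case m≤n⇒m<n∨m≡n (s≤s⁻¹ k<1+m) of λ
      { (inj₁ k<m)  → κ (inj₂ (k , k<m , x))
      ; (inj₂ refl) → κ (inj₁ x)
      }

  -- A directed cycle cannot leave a fibre, so all fibres can be coloured with the same colours.
  small-lex : ∀ K (g : Fin n → ℕ) → (∀ {v} → Y v → g v < K) → (∀ k → k < K → Small M (fibre Y g k)) →
              (∀ {u v} → Y u → Y v → u ⟶ v → g u ≤ g v) → Small M Y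
  small-lex {Y = Y} {M = M} K g g<K sm forward κ = do
    (class , good) ← ¬¬-choice K {P = Good} (λ _ _ → ⊥) λ k k<K κ′ → sm k k<K λ c →
      κ′ (Colouring.class c , Colouring.covers c , Colouring.acyclic c)
    κ record
      { class   = λ i v → class (g v) i v
      ; covers  = λ y → proj₁ (good _ (g<K y)) (y , refl)
      ; acyclic = λ i w → let y = start class w in
          proj₂ (good _ (g<K y)) i (sameFibre class w w (≤-refl))
      }
    where
    Good : ℕ → (Fin M → Pred (Fin n) 0ℓ) → Set
    Good k class = (∀ {v} → fibre Y g k v → ¬ ¬ (∃[ i ] class i v)) ×
                   (∀ i → NoClosedWalk (_⟶_ ↾ (class i ∩ fibre Y g k)))

    module _ (class : ℕ → Fin M → Pred (Fin n) 0ℓ) {i : Fin M} where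
      R : Rel (Fin n) 0ℓ
      R = _⟶_ ↾ ((λ v → class (g v) i v) ∩ Y)

      start : ∀ {k u v} → Walk R (suc k) u v → Y u
      start (((_ , y) , _) ∷ _) = y

      monotone : ∀ {k u v} → Walk R k u v → g u ≤ g v
      monotone []                                = ≤-refl
      monotone (((_ , y) , (_ , y′) , e) ∷ w) = ≤-trans (forward y y′ e) (monotone w)

      sameFibre : ∀ {k l u v x} → Walk R (suc l) x u → Walk R k u v → g v ≤ g x →
                  Walk (_⟶_ ↾ (class (g x) i ∩ fibre Y g (g x))) k u v
      sameFibre pre []      _ = []
      sameFibre {u = u} {x = x} pre (_∷_ {v = y} r@((c , yu) , (d , yv) , e) w) v≤x =
        ((subst (λ k → class k i u) gu c , yu , gu) , (subst (λ k → class k i y) gy d , yv , gy) , e)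
        ∷ sameFibre (pre ∷ʳ r) w v≤x
        where
        gu : g u ≡ g x
        gu = ≤-antisym (≤-trans (monotone (r ∷ w)) v≤x) (monotone pre)
        gy : g y ≡ g x
        gy = ≤-antisym (≤-trans (monotone w) v≤x) (monotone (pre ∷ʳ r))

  -- Consecutive blocks of a vertex order

  record Grouping (Y : Pred (Fin n) 0ℓ) (pos : Fin n → ℕ) (s t : ℕ) : Set₁ where
    field
      count    : ℕ
      block    : Fin n → ℕ
      monotone : ∀ {u v} → block u < block v → pos u < pos v
      bounded  : ∀ v → block v ≤ count
      large    : ∀ {k} → k < count → ¬ Small s (fibre Y block k)
      small    : ∀ {k} → k < count → Small t (fibre Y block k)
      last     : Small s (fibre Y block count)

  module Greedy (Y : Pred (Fin n) 0ℓ) (pos : Fin n → ℕ) (s M : ℕ)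
                (smallFibres : ∀ j → Small M (fibre Y pos j)) where

    group : ℕ → (ℕ → ℕ) → ℕ → Pred (Fin n) 0ℓ
    group p L k v = Y v × pos v < p × L (pos v) ≡ k

    -- Positions below `p` are distributed and group `K` is still being filled. It is closed once it
    -- stops being `Small s`; the fibre added last costs at most `M` further colours.
    record Partial (p : ℕ) : Set₁ where
      field
        K     : ℕ
        L     : ℕ → ℕ
        mono  : ∀ {i j} → i ≤ j → j < p → L i ≤ L j
        bound : ∀ {i} → i < p → L i ≤ K
        large : ∀ {k} → k < K → ¬ Small s (group p L k)
        small : ∀ {k} → k < K → Small (s + M) (group p L k)
        last  : Small s (group p L K)

    module Extend {p : ℕ} (P : Partial p) where
      open Partial P

      L′ : ℕ → ℕ
      L′ i with i ℕ.<? p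
      ... | yes _ = L i
      ... | no  _ = K

      L′-< : ∀ {i} → i < p → L′ i ≡ L i
      L′-< {i} i<p with i ℕ.<? p
      ... | yes _   = refl
      ... | no  i≮p = contradiction i<p i≮p

      L′-p : L′ p ≡ K
      L′-p with p ℕ.<? p
      ... | yes p<p = contradiction p<p (<-irrefl refl)
      ... | no  _   = refl

      bound′ : ∀ {i} → i < suc p → L′ i ≤ K
      bound′ {i} i<1+p with m≤n⇒m<n∨m≡n (s≤s⁻¹ i<1+p)
      ... | inj₁ i<p  = subst (_≤ K) (sym (L′-< i<p)) (bound i<p)
      ... | inj₂ refl = ≤-reflexive L′-p

      mono′ : ∀ {i j} → i ≤ j → j < suc p → L′ i ≤ L′ j
      mono′ {i} {j} i≤j j<1+p with m≤n⇒m<n∨m≡n (s≤s⁻¹ j<1+p)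
      ... | inj₁ j<p  = subst₂ _≤_ (sym (L′-< (≤-<-trans i≤j j<p))) (sym (L′-< j<p)) (mono i≤j j<p)
      ... | inj₂ refl = subst (L′ i ≤_) (sym L′-p) (bound′ (s≤s i≤j))

      old⊆new : ∀ {k} → group p L k ⊆ group (suc p) L′ k
      old⊆new (y , pos<p , eq) = y , m≤n⇒m≤1+n pos<p , trans (L′-< pos<p) eq

      new⊆old : ∀ {k} → k < K → group (suc p) L′ k ⊆ group p L k
      new⊆old k<K (y , pos<1+p , eq) with m≤n⇒m<n∨m≡n (s≤s⁻¹ pos<1+p)
      ... | inj₁ pos<p = y , pos<p , trans (sym (L′-< pos<p)) eq
      ... | inj₂ pos≡p =
        contradiction (trans (sym L′-p) (trans (cong L′ (sym pos≡p)) eq)) (>⇒≢ k<K)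

      newK : Small (s + M) (group (suc p) L′ K)
      newK = small-∪ last (smallFibres p) λ (y , pos<1+p , eq) κ → case m≤n⇒m<n∨m≡n (s≤s⁻¹ pos<1+p) of λ
        { (inj₁ pos<p) → κ (inj₁ (y , pos<p , trans (sym (L′-< pos<p)) eq))
        ; (inj₂ pos≡p) → κ (inj₂ (y , pos≡p))
        }

      extend : ¬ ¬ Partial (suc p)
      extend κ = em (Small s (group (suc p) L′ K)) λ
        { (yes sm) → κ record
            { K = K ; L = L′ ; mono = mono′ ; bound = bound′
            ; large = λ k<K → large k<K ∘ small-⊆ old⊆new
            ; small = λ k<K → small-⊆ (new⊆old k<K) (small k<K)
            ; last  = sm
            }
        ; (no ¬sm) → κ record
            { K = suc K ; L = L′ ; mono = mono′ ; bound = m≤n⇒m≤1+n ∘ bound′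
            ; large = λ k≤K → case m≤n⇒m<n∨m≡n (s≤s⁻¹ k≤K) of λ
                { (inj₁ k<K)  → large k<K ∘ small-⊆ old⊆new
                ; (inj₂ refl) → ¬sm
                }
            ; small = λ k≤K → case m≤n⇒m<n∨m≡n (s≤s⁻¹ k≤K) of λ
                { (inj₁ k<K)  → small-⊆ (new⊆old k<K) (small k<K)
                ; (inj₂ refl) → newK
                }
            ; last  = small-∅ λ (_ , pos<1+p , eq) → <-irrefl eq (s≤s (bound′ pos<1+p))
            }
        }

    partialGrouping : ∀ p → ¬ ¬ Partial p
    partialGrouping zero    κ = κ record
      { K = 0 ; L = λ _ → 0 ; mono = λ _ () ; bound = λ () ; large = λ () ; small = λ ()
      ; last = small-∅ λ { (_ , () , _) } }
    partialGrouping (suc p) κ = do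
      P ← partialGrouping p
      Extend.extend P κ

  grouping : ∀ s {pos : Fin n → ℕ} → (∀ v → pos v ≤ n) → (∀ j → Small M (fibre Y pos j)) →
             ¬ ¬ Grouping Y pos s (s + M)
  grouping {M} {Y} s {pos} pos≤n smallFibres κ = do
    P ← partialGrouping (suc n)
    let open Partial P
    κ record
      { count    = K
      ; block    = L ∘ pos
      ; monotone = λ {u} {v} b< → ≰⇒> λ v≤u → <⇒≱ b< (mono v≤u (s≤s (pos≤n u)))
      ; bounded  = λ v → bound (s≤s (pos≤n v))
      ; large    = λ k<K → large k<K ∘ small-⊆ (λ (y , _ , eq) → y , eq)
      ; small    = λ k<K → small-⊆ (λ (y , eq) → y , s≤s (pos≤n _) , eq) (small k<K)
      ; last     = small-⊆ (λ (y , eq) → y , s≤s (pos≤n _) , eq) last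
      }
    where open Greedy Y pos s M smallFibres

  -- Greedy grouping along `Fin n`, where fibres are single vertices. With fewer than `r` large
  -- blocks there would be at most `r` blocks in all, each `Small (suc s)`, hence too few colours on
  -- `Y`.
  pieces : ∀ r s → ¬ Small (r * suc s) Y →
           ¬ ¬ (Σ[ f ∈ (Fin n → ℕ) ] ∀ {k} → k < r → ¬ Small s (fibre Y f k))
  pieces {Y} r s ¬sm κ = do
    G ← grouping {M = 1} {Y = Y} s {toℕ} (<⇒≤ ∘ toℕ<n) λ j →
          small-singleton λ (_ , u≡j) (_ , v≡j) → toℕ-injective (trans u≡j (sym v≡j))
    let open Grouping G
    case count ℕ.<? r of λ
      { (no  count≮r) → κ (block , λ k<r → large (<-≤-trans k<r (≮⇒≥ count≮r)))
      ; (yes count<r) → ¬sm (small-≤ (*-monoˡ-≤ (suc s) count<r) (small-⋃ (suc count) {fibre Y block}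
          (λ k k≤ → case m≤n⇒m<n∨m≡n (s≤s⁻¹ k≤) of λ
            { (inj₁ k<)   → small-≤ (≤-reflexive (+-comm s 1)) (small k<)
            ; (inj₂ refl) → small-≤ (n≤1+n s) last
            })
          λ {v} y κ′ → κ′ (block v , s≤s (bounded v) , y , refl)))
      }

-- Subdigraphs of large digirth and their covers

module LongGirth (ℓ : ℕ) where

  module Covers {n : ℕ} (T : Tournament n) where
    open Smallness T public

    -- The closed walk has length `suc k`, so `ℓ ≤ k` makes it longer than `ℓ`. Closed walks can
    -- replace cycles because each contains a cycle that is no longer.
    record Girthy (R : Rel (Fin n) 0ℓ) : Set where
      field
        arcs  : ∀ {u v} → R u v → u ⟶ v
        girth : ∀ {k v} → Walk R (suc k) v v → ℓ ≤ k

    infixl 6 _∖⋃_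

    _∖⋃_ : ∀ {a} → Pred (Fin n) 0ℓ → (Fin a → Pred (Fin n) 0ℓ) → Pred (Fin n) 0ℓ
    (Y ∖⋃ class) v = Y v × ∀ i → ¬ class i v

    Separates : ∀ {a} → Rel (Fin n) 0ℓ → Pred (Fin n) 0ℓ → (Fin a → Pred (Fin n) 0ℓ) → Set
    Separates R Y class = ∀ i → NoClosedWalk (R ↾ (class i ∩ Y))

    record Cover (a b : ℕ) (R : Rel (Fin n) 0ℓ) (Y : Pred (Fin n) 0ℓ) : Set₁ where
      field
        class   : Fin a → Pred (Fin n) 0ℓ
        acyclic : Separates R Y class
        rest    : Small b (Y ∖⋃ class)

    Coverable : ℕ → ℕ → Pred (Fin n) 0ℓ → Set₁
    Coverable a b Y = ∀ {R} → Girthy R → ¬ ¬ Cover a b R Y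

    private variable
      X Y Z : Pred (Fin n) 0ℓ

    ∅-girthy : Girthy λ _ _ → ⊥
    ∅-girthy = record { arcs = λ () ; girth = λ { (() ∷ _) } }

    ↾-girthy : ∀ {R} → Girthy R → Girthy (R ↾ Y)
    ↾-girthy g = record { arcs = λ (_ , _ , r) → arcs r ; girth = λ w → girth (mapWalk (λ (_ , _ , r) → r) w) }
      where open Girthy g

    module _ (m : ℕ) (f : Fin n → ℕ) (Rs : ℕ → Rel (Fin n) 0ℓ) where

      union : Rel (Fin n) 0ℓ
      union u v = f u < m × f u ≡ f v × Rs (f u) u v

      private
        inFibre : ∀ {j k u v} → f u ≡ j → Walk union k u v → Walk (Rs j) k u v
        inFibre eq []                       = []
        inFibre eq ((_ , u≡v , r) ∷ w) =
          subst (λ i → Rs i _ _) eq r ∷ inFibre (trans (sym u≡v) eq) w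

      -- Arcs of the union preserve `f`, so a closed walk lies in a single `Rs k`.
      union-girthy : (∀ k → k < m → Girthy (Rs k)) → Girthy union
      union-girthy g = record
        { arcs  = λ (u<m , _ , r) → Girthy.arcs (g _ u<m) r
        ; girth = λ { w@((u<m , _) ∷ _) → Girthy.girth (g _ u<m) (inFibre refl w) }
        }

    -- Each drop in a closed walk is made up for by at least ℓ climbs.
    levelArcs : (Fin n → ℕ) → Rel (Fin n) 0ℓ
    levelArcs lev u v = u ⟶ v × (lev v ≡ suc (lev u) ⊎ lev v + ℓ ≤ lev u)

    module _ {E : Rel (Fin n) 0ℓ} {lev : Fin n → ℕ} (horizontal : ∀ {u v} → E u v → lev u ≡ lev v) where

      levelled : Rel (Fin n) 0ℓ
      levelled u v = E u v ⊎ levelArcs lev u v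

      private
        climb : ∀ {k u v} → Walk levelled k u v → lev v ≤ lev u + k
        climb []      = m≤m+n _ 0
        climb {suc k} {u} (r ∷ w) =
          ≤-trans (climb w) (≤-trans (+-monoˡ-≤ k (one r)) (≤-reflexive (sym (+-suc (lev u) k))))
          where
          one : ∀ {x} → levelled u x → lev x ≤ suc (lev u)
          one (inj₁ e)              = ≤-trans (≤-reflexive (sym (horizontal e))) (n≤1+n _)
          one (inj₂ (_ , inj₁ up))   = ≤-reflexive up
          one (inj₂ (_ , inj₂ down)) = m≤n⇒m≤1+n (≤-trans (m≤m+n _ ℓ) down)

        -- The cases are: no level arc, climbs but no drop, at least one drop. In the last, one of
        -- the `k` arcs loses `ℓ` levels and the other arcs gain at most one level each. A closed
        -- walk cannot be rising.
        data Shape (k : ℕ) (u v : Fin n) : Set where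
          level    : lev u ≡ lev v → Walk E k u v → Shape k u v
          rising   : lev u < lev v → Shape k u v
          dropping : suc (lev v + ℓ) ≤ lev u + k → Shape k u v

        shape : ∀ {k u v} → Walk levelled k u v → Shape k u v
        shape [] = level refl []
        shape {suc k} {u} {v} (inj₁ e ∷ w) with shape w
        ... | level eq w′ = level (trans (horizontal e) eq) (e ∷ w′)
        ... | rising lt   = rising (subst (_< lev v) (sym (horizontal e)) lt)
        ... | dropping le = dropping (≤-trans le
          (subst (λ j → j + k ≤ lev u + suc k) (horizontal e) (+-monoʳ-≤ (lev u) (n≤1+n k))))
        shape {suc k} {u} {v} (inj₂ (_ , inj₁ up) ∷ w) with shape w
        ... | level eq _  = rising (≤-reflexive (trans (sym up) eq))
        ... | rising lt   = rising (<-trans (≤-reflexive (sym up)) lt)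
        ... | dropping le = dropping (≤-trans le (≤-reflexive (trans (cong (_+ k) up) (sym (+-suc (lev u) k)))))
        shape {suc k} {u} {v} (inj₂ (_ , inj₂ down) ∷ w) =
          dropping (≤-trans (s≤s le) (≤-reflexive (sym (+-suc (lev u) k))))
          where
          le : lev v + ℓ ≤ lev u + k
          le = ≤-trans (+-monoˡ-≤ ℓ (climb w)) (≤-trans (≤-reflexive eq) (+-monoˡ-≤ k down))
            where
            eq : ∀ {x} → x + k + ℓ ≡ x + ℓ + k
            eq {x} = trans (+-assoc x k ℓ) (trans (cong (x +_) (+-comm k ℓ)) (sym (+-assoc x ℓ k)))

      levelled-girthy : Girthy E → Girthy levelled
      levelled-girthy g = record { arcs = [ arcs , proj₁ ]′ ; girth = λ {k} {v} w → long w (shape w) }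
        where
        open Girthy g
        long : ∀ {k v} → Walk levelled (suc k) v v → Shape (suc k) v v → ℓ ≤ k
        long _ (level _ w)   = girth w
        long _ (rising lt)   = contradiction lt (<-irrefl refl)
        long {k} {v} _ (dropping le) =
          +-cancelˡ-≤ (lev v) ℓ k (s≤s⁻¹ (≤-trans le (≤-reflexive (+-suc (lev v) k))))

  -- The induction statement and its consequences for large sets

  Bounded : ℕ → ℕ → Set₁
  Bounded a b = Σ[ F ∈ ℕ ] (∀ {n} (T : Tournament n) Y → Covers.Coverable T a b Y → Covers.Small T F Y)

  bounded-zero : ∀ b → Bounded 0 b
  bounded-zero b = b , λ T Y coverable κ → let open Covers T in do
    c ← coverable ∅-girthy
    Cover.rest c λ col → small-⊆ (λ y → y , λ ()) (λ κ′ → κ′ col) κ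

  -- The induction hypothesis for one colour fewer. At `b = 0` there is no smaller case, and
  -- `Bounded 0 0`, which always holds, fills the place.
  BoundedBelow : ℕ → ℕ → Set₁
  BoundedBelow a zero    = Bounded 0 0
  BoundedBelow a (suc b) = Bounded a b

  presentThreshold : ∀ a b → BoundedBelow a b → ℕ
  presentThreshold a zero    _       = 0
  presentThreshold a (suc b) (F , _) = F

  module Blocks {n : ℕ} (T : Tournament n) where
    open Covers T public

    private variable
      Y Z : Pred (Fin n) 0ℓ

    uncoverable : ∀ {a b} ((F , _) : Bounded a b) → ¬ Small F Y →
                  ¬ ¬ (Σ[ R ∈ Rel (Fin n) 0ℓ ] Girthy R × ¬ Cover a b R Y)
    uncoverable (F , bound) ¬sm κ = ¬sm (bound T _ λ {R} g ¬c → κ (R , g , ¬c))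

    record Dense (a b t : ℕ) (Z : Pred (Fin n) 0ℓ) (R : Rel (Fin n) 0ℓ) : Set₁ where
      field
        dense : ∀ (class : Fin a → Pred (Fin n) 0ℓ) → Separates R Z class →
                Small b (Z ∖⋃ class) → ∀ i → ¬ Small t (class i ∩ Z)

    record Present (a b : ℕ) (Z : Pred (Fin n) 0ℓ) (R : Rel (Fin n) 0ℓ) : Set₁ where
      field
        present : ∀ (class : Fin a → Pred (Fin n) 0ℓ) → Separates R Z class →
                  (c : Colouring b (Z ∖⋃ class)) → ∀ i →
                  ¬ ¬ (∃[ v ] (Z ∖⋃ class) v × Colouring.class c i v)

    -- `R` is chosen without an `(a , b + t)`-cover. A class that is `Small t` could be dissolved
    -- into the rest for `t` more colours, leaving such a cover.
    exists-dense : ∀ {a b t} (bounded : Bounded a (b + t)) → ¬ Small (proj₁ bounded) Z →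
                   ¬ ¬ (∃[ R ] Girthy R × Dense (suc a) b t Z R)
    exists-dense bounded ¬sm κ = do
      (R , g , ¬cover) ← uncoverable bounded ¬sm
      κ (R , g , record { dense = λ class sep rest i sm → ¬cover record
        { class   = class ∘ punchIn i
        ; acyclic = sep ∘ punchIn i
        ; rest    = small-∪ rest sm λ {v} (z , ∉) κ′ → em (class i v) λ
            { (yes c) → κ′ (inj₂ (c , z))
            ; (no ¬c) → κ′ (inj₁ (z , λ j c → case i ≟ j of λ
                { (yes refl) → ¬c c
                ; (no i≢j)   → ∉ (punchOut i≢j) (subst (λ k → class k v) (sym (punchIn-punchOut i≢j)) c)
                }))
            }
        } })

    -- `R` is chosen without a cover that has one colour fewer, whereas an absent colour could be
    -- dropped. Without colours the claim is vacuous and the empty digraph serves.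
    exists-present : ∀ {a} b (bounded : BoundedBelow a b) → ¬ Small (presentThreshold a b bounded) Z →
                     ¬ ¬ (∃[ R ] Girthy R × Present a b Z R)
    exists-present zero    bounded ¬sm κ = κ (_ , ∅-girthy , record { present = λ _ _ _ () })
    exists-present (suc b) bounded ¬sm κ = do
      (R , g , ¬cover) ← uncoverable bounded ¬sm
      κ (R , g , record { present = λ class sep c i absent →
        let open Colouring c renaming (class to colour) in ¬cover record
          { class   = class
          ; acyclic = sep
          ; rest    = λ κ′ → κ′ record
              { class   = colour ∘ punchIn i
              ; covers  = λ {v} z κ″ → covers z λ (j , cj) → case i ≟ j of λ
                  { (yes refl) → absent (v , z , cj)
                  ; (no i≢j)   → κ″ (punchOut i≢j , subst (λ k → colour k v) (sym (punchIn-punchOut i≢j)) cj)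
                  }
              ; acyclic = acyclic ∘ punchIn i
              }
          } })

    module _ {a b : ℕ} where

      dense-⊆ : ∀ {t R S} → Y ⊆ Z → (∀ {u v} → Y u → Y v → R u v → S u v) →
                Dense a b t Y R → Dense a b t Z S
      dense-⊆ Y⊆Z R⊆S d = record { dense = λ class sep rest i →
        Dense.dense d class
          (λ j → noClosedWalk-⊆ (λ ((c , x) , (c′ , y) , r) → (c , Y⊆Z x) , (c′ , Y⊆Z y) , R⊆S x y r) (sep j))
          (small-⊆ (λ (y , ∉) → Y⊆Z y , ∉) rest) i
        ∘ small-⊆ (λ (c , y) → c , Y⊆Z y) }

      present-⊆ : ∀ {R S} → Y ⊆ Z → (∀ {u v} → Y u → Y v → R u v → S u v) →
                  Present a b Y R → Present a b Z S
      present-⊆ Y⊆Z R⊆S p = record { present = λ class sep c i κ → do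
        (v , (y , ∉) , cv) ← Present.present p class
          (λ j → noClosedWalk-⊆ (λ ((c , x) , (c′ , y) , r) → (c , Y⊆Z x) , (c′ , Y⊆Z y) , R⊆S x y r) (sep j))
          (restrictColouring (λ (y , ∉) → Y⊆Z y , ∉) c) i
        κ (v , (Y⊆Z y , ∉) , cv) }

  -- The inductive step

  module Step (a b : ℕ) (bounded₁ : ∀ b → Bounded a b) (bounded₂ : BoundedBelow (suc a) b) where

    richThreshold : ℕ → ℕ
    richThreshold t = 2 * suc (proj₁ (bounded₁ (b + t)) + presentThreshold (suc a) b bounded₂)

    -- Odd, so that sets placed alternately on the levels `0` to `lastLevel` also alternate across
    -- the return to `0`; greater than `ℓ`, so that this return is an allowed drop.
    lastLevel : ℕ
    lastLevel = suc (ℓ + ℓ)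

    mutualThreshold : ℕ → ℕ
    mutualThreshold τ = suc lastLevel * suc (richThreshold (τ + τ))

    splitThreshold : ℕ → ℕ
    splitThreshold τ = 2 * suc (mutualThreshold τ)

    chainThreshold : ℕ → ℕ → ℕ
    chainThreshold zero    s = s
    chainThreshold (suc m) s = splitThreshold (chainThreshold m s + s)

    triangleThreshold : ℕ
    triangleThreshold = chainThreshold ℓ (richThreshold 0) + richThreshold 0

    betweenThreshold : ℕ
    betweenThreshold = mutualThreshold triangleThreshold

    precedesThreshold : ℕ
    precedesThreshold = betweenThreshold + suc betweenThreshold

    backThreshold : ℕ
    backThreshold = splitThreshold precedesThreshold

    fibreThreshold : ℕ
    fibreThreshold = splitThreshold backThreshold

    blockThreshold : ℕ
    blockThreshold = richThreshold (backThreshold + backThreshold)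

    -- The summands account for the unfinished last block, for the `suc a` classes on the other
    -- blocks, and for the `b` colours.
    bound : ℕ
    bound = blockThreshold + (suc a * (suc (suc ℓ) * (blockThreshold + fibreThreshold)) + b)

    module On {n : ℕ} (T : Tournament n) where
      open Blocks T public

      Class : Set₁
      Class = Fin (suc a) → Pred (Fin n) 0ℓ

      record Rich (t : ℕ) (Z : Pred (Fin n) 0ℓ) (R : Rel (Fin n) 0ℓ) : Set₁ where
        field
          isDense   : Dense (suc a) b t Z R
          isPresent : Present (suc a) b Z R

      -- Density and presence come from two digraphs on disjoint large pieces of `Z`; both
      -- properties survive enlarging the set and the digraph.
      exists-rich : ∀ t {Z} → ¬ Small (richThreshold t) Z → ¬ ¬ (∃[ R ] Girthy R × Rich t Z R)
      exists-rich t {Z} ¬sm κ = do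
        (f , large) ← pieces 2 _ ¬sm
        (R₀ , g₀ , d) ← exists-dense (bounded₁ (b + t)) (large {0} z<s ∘ small-≤ (m≤m+n _ _))
        (R₁ , g₁ , p) ← exists-present b bounded₂ (large {1} ≤-refl ∘ small-≤ (m≤n+m _ (proj₁ (bounded₁ (b + t)))))
        let Rs : ℕ → Rel (Fin n) 0ℓ
            Rs = λ { zero → R₀ ; (suc _) → R₁ }
        κ (union 2 f Rs
          , union-girthy 2 f Rs (λ { zero _ → g₀ ; (suc _) _ → g₁ })
          , record
            { isDense   = dense-⊆ proj₁ (λ { (_ , refl′) (_ , eq) r → within 0 z<s Rs refl′ eq r }) d
            ; isPresent = present-⊆ proj₁ (λ { (_ , refl′) (_ , eq) r → within 1 ≤-refl Rs refl′ eq r }) p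
            })
        where
        within : ∀ {m} {f : Fin n → ℕ} k → k < m → (Rs : ℕ → Rel (Fin n) 0ℓ) → ∀ {u v} →
                 f u ≡ k → f v ≡ k → Rs k u v → union m f Rs u v
        within k k<m Rs refl eq r = k<m , sym eq , r

      module _ {Y : Pred (Fin n) 0ℓ} (coverable : Coverable (suc a) b Y) where

        -- What a cover of the digraph consisting of the level arcs on Z
        -- and of rich digraphs inside the levels below m looks like.
        record LevelCover (Z : Pred (Fin n) 0ℓ) (lev : Fin n → ℕ) (m t : ℕ) : Set₁ where
          field
            class     : Class
            colouring : Colouring b (Y ∖⋃ class)
            acyclic   : Separates (levelArcs lev) Z class
            dense     : ∀ {k} → k < m → ∀ i → ¬ Small t (class i ∩ fibre Z lev k)
            present   : ∀ {k} → k < m → ∀ i →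
                        ¬ ¬ (∃[ v ] fibre Z lev k v × (Y ∖⋃ class) v × Colouring.class colouring i v)

        levelCover : ∀ {Z lev m} t → Z ⊆ Y → (∀ {k} → k < m → ¬ Small (richThreshold t) (fibre Z lev k)) →
                     ¬ ¬ LevelCover Z lev m t
        levelCover {Z} {lev} {m} t Z⊆Y large κ = do
          (Rs , good) ← ¬¬-choice m {P = λ k R → Girthy R × Rich t (fibre Z lev k) R} (λ _ _ → ⊥)
                          λ k k<m → exists-rich t (large k<m)
          let E = union m lev Rs
              horizontal : ∀ {u v} → E u v → lev u ≡ lev v
              horizontal = λ e → proj₁ (proj₂ e)
          c ← coverable (levelled-girthy horizontal (union-girthy m lev Rs λ k k<m → proj₁ (good k k<m)))
          let open Cover c
          colouring ← rest
          let fibre⊆Y : ∀ {k} → fibre Z lev k ⊆ Y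
              fibre⊆Y = Z⊆Y ∘ proj₁
              sep : ∀ {k} → k < m → Separates (Rs k) (fibre Z lev k) class
              sep = λ {k} k<m i → noClosedWalk-⊆ (λ { ((c , z , refl) , (c′ , z′ , eq) , r) →
                (c , Z⊆Y z) , (c′ , Z⊆Y z′) , inj₁ (k<m , sym eq , r) }) (acyclic i)
          κ record
            { class     = class
            ; colouring = colouring
            ; acyclic   = λ i → noClosedWalk-⊆ (λ ((c , z) , (c′ , z′) , r) →
                            (c , Z⊆Y z) , (c′ , Z⊆Y z′) , inj₂ r) (acyclic i)
            ; dense     = λ {k} k<m → Dense.dense (Rich.isDense (proj₂ (good k k<m))) class (sep k<m)
                            (small-⊆ (λ (y , ∉) → fibre⊆Y y , ∉) rest)
            ; present   = λ {k} k<m i κ′ → do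
                (v , (z , ∉) , cv) ← Present.present (Rich.isPresent (proj₂ (good k k<m))) class (sep k<m)
                                       (restrictColouring (λ (y , ∉) → fibre⊆Y y , ∉) colouring) i
                κ′ (v , z , (fibre⊆Y z , ∉) , cv)
            }

        private variable
          A B Z : Pred (Fin n) 0ℓ
          s τ : ℕ

        -- Complete pairs of large sets

        Complete : Pred (Fin n) 0ℓ → Pred (Fin n) 0ℓ → Set
        Complete A B = ∀ {u v} → A u → B v → u ⟶ v

        -- For disjoint `A` and `B` this provides an arc from any large part of `A` to any large
        -- part of `B`.
        Forward : ℕ → Pred (Fin n) 0ℓ → Pred (Fin n) 0ℓ → Set₁
        Forward τ A B = ∀ {A′ B′} → A′ ⊆ A → B′ ⊆ B → Complete B′ A′ → ¬ Small τ A′ → ¬ ¬ Small τ B′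

        forward-⊆ : ∀ {A′ B′} → A′ ⊆ A → B′ ⊆ B → Forward τ A B → Forward τ A′ B′
        forward-⊆ A′⊆A B′⊆B f A″⊆A′ B″⊆B′ = f (A′⊆A ∘ A″⊆A′) (B′⊆B ∘ B″⊆B′)

        module _ {Q : Rel (Fin n) 0ℓ} (D : ℕ → Pred (Fin n) 0ℓ) (N : ℕ) (K : Pred (Fin n) 0ℓ)
                 (forward  : ∀ t → t < N → Forward τ (D t) (D (suc t)))
                 (disjoint : ∀ t → t < N → ∀ {u} → D t u → ¬ D (suc t) u)
                 (arcs     : ∀ t → t < N → ∀ {u v} → D t u → D (suc t) v → u ⟶ v → Q u v)
                 (large    : ∀ t → t ≤ N → ¬ Small (τ + τ) (D t))
                 (target   : Small τ (λ v → D N v × ¬ K v)) where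

          Reaches : ℕ → Pred (Fin n) 0ℓ
          Reaches j u = ∃[ v ] K v × Walk Q j u v

          -- The loss does not accumulate: the vertices of D t without an arc to the good
          -- part of D (suc t) are dominated by all of that part.
          reach : ∀ j t → t + j ≡ N → Small τ (λ u → D t u × ¬ Reaches j u)
          reach zero    t eq = small-⊆
            (λ {u} (d , ¬r) → subst (λ i → D i u) (trans (sym (+-identityʳ t)) eq) d , λ k → ¬r (u , k , [])) target
          reach (suc j) t eq = small-stable λ ¬sm →
            forward t t<N proj₁ proj₁ dominates ¬sm ¬smallGood
            where
            t+j : suc t + j ≡ N
            t+j = trans (sym (+-suc t j)) eq
            t<N : t < N
            t<N = ≤-trans (m≤m+n (suc t) j) (≤-reflexive t+j)
            Good : Pred (Fin n) 0ℓ
            Good v = D (suc t) v × Reaches j v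
            ¬smallGood : ¬ Small τ Good
            -- Vertices that do not reach `K` take up `τ` colours; since `D (suc t)` is not
            -- `Small (τ + τ)`, the others still need more than `τ`.
            ¬smallGood sm = large (suc t) t<N (small-∪ sm (reach j (suc t) t+j) λ {v} d κ →
              em (Reaches j v) λ { (yes r) → κ (inj₁ (d , r)) ; (no ¬r) → κ (inj₂ (d , ¬r)) })
            dominates : Complete Good (λ u → D t u × ¬ Reaches (suc j) u)
            dominates {v} {u} (dv , z , k , w) (du , ¬r) with total (λ { refl → disjoint t t<N du dv })
            ... | inj₁ vu = vu
            ... | inj₂ uv = contradiction (z , k , arcs t t<N du dv uv ∷ w) ¬r

        module Cyclic {Z : Pred (Fin n) 0ℓ} {f : Fin n → ℕ} {m : ℕ} (Z⊆Y : Z ⊆ Y) (ℓ<m : ℓ < m)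
                      (large   : ∀ {k} → k < suc m → ¬ Small (richThreshold (τ + τ)) (fibre Z f k))
                      (forward : ∀ {k} → k < m → Forward τ (fibre Z f k) (fibre Z f (suc k)))
                      (wrap    : Forward τ (fibre Z f m) (fibre Z f 0)) where

          next : ℕ → ℕ
          next k with k ℕ.<? m
          ... | yes _ = suc k
          ... | no  _ = 0

          phase : ℕ → ℕ
          phase zero    = 0
          phase (suc t) = next (phase t)

          next-≤ : ∀ k → next k ≤ m
          next-≤ k with k ℕ.<? m
          ... | yes k<m = k<m
          ... | no  _   = z≤n

          phase-≤ : ∀ t → phase t ≤ m
          phase-≤ zero    = z≤n
          phase-≤ (suc t) = next-≤ (phase t)

          next-≢ : ∀ k → k ≤ m → k ≢ next k
          next-≢ k k≤m with k ℕ.<? m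
          ... | yes _   = <⇒≢ ≤-refl
          ... | no  k≮m = λ { refl → k≮m (≤-<-trans z≤n ℓ<m) }

          forward′ : ∀ k → k ≤ m → Forward τ (fibre Z f k) (fibre Z f (next k))
          forward′ k k≤m with k ℕ.<? m
          ... | yes k<m = forward k<m
          ... | no  k≮m = subst (λ j → Forward τ (fibre Z f j) (fibre Z f 0)) (≤-antisym (≮⇒≥ k≮m) k≤m) wrap

          next-arc : ∀ {u v} k → k ≤ m → f u ≡ k → f v ≡ next k → u ⟶ v → levelArcs f u v
          next-arc k k≤m refl fv uv with k ℕ.<? m
          ... | yes _   = uv , inj₁ fv
          ... | no  k≮m = uv , inj₂ (≤-trans (≤-reflexive (cong (_+ ℓ) fv)) (≤-trans (<⇒≤ ℓ<m) (≮⇒≥ k≮m)))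

          -- `D t` follows one class round and round the levels. Some vertex of `D 0` starts a walk
          -- of `n` arcs inside the class, and such a walk contains a closed one.
          impossible : ⊥
          impossible = do
            cover ← levelCover (τ + τ) Z⊆Y large
            let open LevelCover cover
                C = class fzero
                D = λ t → C ∩ fibre Z f (phase t)
                large′ : ∀ t → t ≤ n → ¬ Small (τ + τ) (D t)
                large′ = λ t _ → dense (s≤s (phase-≤ t)) fzero
                unreachable = reach {Q = levelArcs f ↾ (C ∩ Z)} D n (D n)
                  (λ t _ → forward-⊆ proj₂ proj₂ (forward′ (phase t) (phase-≤ t)))
                  (λ t _ (_ , _ , eq) (_ , _ , eq′) → next-≢ (phase t) (phase-≤ t) (trans (sym eq) eq′))
                  (λ t _ (c , z , eq) (c′ , z′ , eq′) uv →
                    (c , z) , (c′ , z′) , next-arc (phase t) (phase-≤ t) eq eq′ uv)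
                  large′
                  (small-∅ λ (d , ¬d) → ¬d d)
                  n 0 refl
            large′ 0 z≤n (small-≤ (m≤m+n τ τ) (small-⊆ (λ d → d , λ (_ , _ , w) →
              let _ , _ , c = longWalk⇒closedWalk w in acyclic fzero c) unreachable))

        -- Pieces of `A` on the even levels and of `B` on the odd ones form a cyclic sequence with
        -- every step forward, so `Cyclic` applies.
        mutual-forward : A ⊆ Y → B ⊆ Y → (∀ {v} → A v → ¬ B v) → Forward τ A B → Forward τ B A →
                         ¬ Small (mutualThreshold τ) A → ¬ ¬ Small (mutualThreshold τ) B
        mutual-forward {A} {B} {τ} A⊆Y B⊆Y disjoint AB BA ¬smA ¬smB = do
          (fA , largeA) ← pieces (suc lastLevel) _ ¬smA
          (fB , largeB) ← pieces (suc lastLevel) _ ¬smB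
          A? ← ¬¬-all n λ v → em (A v)
          let f : Fin n → ℕ
              f v = pick (A? v) (fA v) (fB v)
              f-A : ∀ {v} → A v → f v ≡ fA v
              f-A {v} = pick-yes (A? v)
              f-B : ∀ {v} → B v → f v ≡ fB v
              f-B {v} y = pick-no (A? v) (λ x → disjoint x y)
              Z : Pred (Fin n) 0ℓ
              Z v = A v × even (fA v) ≡ true ⊎ B v × even (fB v) ≡ false
              inSide : ∀ k c → even k ≡ c → fibre Z f k ⊆ side c
              inSide = λ
                { k true  _   (inj₁ (x , _) , _)   → x
                ; k true  ek  (inj₂ (y , ef) , eq) →
                    case trans (sym ek) (trans (cong even (trans (sym eq) (f-B y))) ef) of λ ()
                ; k false ek  (inj₁ (x , ef) , eq) →
                    case trans (sym ek) (trans (cong even (trans (sym eq) (f-A x))) ef) of λ ()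
                ; k false _   (inj₂ (y , _) , _)   → y
                }
              large : ∀ {k} c → even k ≡ c → k < suc lastLevel → ¬ Small (richThreshold (τ + τ)) (fibre Z f k)
              large = λ
                { true  ek k< → largeA k< ∘ small-⊆ λ { (x , refl) → inj₁ (x , ek) , f-A x }
                ; false ek k< → largeB k< ∘ small-⊆ λ { (y , refl) → inj₂ (y , ek) , f-B y }
                }
          Cyclic.impossible {Z = Z} {f = f} {m = lastLevel} [ A⊆Y ∘ proj₁ , B⊆Y ∘ proj₁ ]′ (s≤s (m≤m+n ℓ ℓ))
            (λ {k} → large {k} (even k) refl)
            (λ {k} _ → forward-⊆ (inSide k (even k) refl) (inSide (suc k) (not (even k)) refl) (sides (even k)))
            (forward-⊆ (inSide lastLevel false (cong not (even-double ℓ))) (inSide 0 true refl) BA)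
          where
          side : Bool → Pred (Fin n) 0ℓ
          side true  = A
          side false = B
          sides : ∀ c → Forward τ (side c) (side (not c))
          sides true  = AB
          sides false = BA

        small-if-forward : Z ⊆ Y → (∀ {A B} → A ⊆ Z → B ⊆ Z → Forward τ A B) → Small (splitThreshold τ) Z
        small-if-forward Z⊆Y forward = small-stable λ ¬sm → do
          (f , large) ← pieces 2 _ ¬sm
          mutual-forward (Z⊆Y ∘ proj₁) (Z⊆Y ∘ proj₁) (λ { (_ , refl′) (_ , eq) → case trans (sym refl′) eq of λ () })
            (forward proj₁ proj₁) (forward proj₁ proj₁) (large {0} z<s) (large {1} ≤-refl)

        -- A set complete to a large, hence nonempty, set lies in the in-neighbourhood of one
        -- vertex; so any two parts of `Z` are forward.
        small-if-small-in : Z ⊆ Y → (∀ {v} → Z v → Small τ (Z ∩ (_⟶ v))) → Small (splitThreshold τ) Z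
        small-if-small-in Z⊆Y small = small-if-forward Z⊆Y λ A⊆Z B⊆Z A′⊆A B′⊆B complete ¬smA ¬smB → do
          (v , x) ← nonempty ¬smA
          ¬smB (small-⊆ (λ y → B⊆Z (B′⊆B y) , complete y x) (small (A⊆Z (A′⊆A x))))

        small-if-small-out : Z ⊆ Y → (∀ {v} → Z v → Small τ (Z ∩ (v ⟶_))) → Small (splitThreshold τ) Z
        small-if-small-out Z⊆Y small = small-if-forward Z⊆Y λ A⊆Z B⊆Z A′⊆A B′⊆B complete ¬smA ¬smB → do
          (v , y) ← nonempty ¬smB
          ¬smA (small-⊆ (λ x → A⊆Z (A′⊆A x) , complete y x) (small (B⊆Z (B′⊆B y))))

        complete-pair : Z ⊆ Y → ¬ Small (splitThreshold τ) Z →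
                        ¬ ¬ (∃[ A ] ∃[ B ] A ⊆ Z × B ⊆ Z × Complete A B × ¬ Small τ A × ¬ Small τ B)
        complete-pair Z⊆Y ¬sm κ = ¬sm (small-if-forward Z⊆Y λ A⊆Z B⊆Z A′⊆A B′⊆B complete ¬smA ¬smB →
          κ (_ , _ , B⊆Z ∘ B′⊆B , A⊆Z ∘ A′⊆A , complete , ¬smB , ¬smA))

        -- Chains of large sets and triangles through a vertex

        record Chain (m s : ℕ) (Z : Pred (Fin n) 0ℓ) : Set₁ where
          field
            carrier  : Pred (Fin n) 0ℓ
            level    : Fin n → ℕ
            within   : carrier ⊆ Z
            level-≤  : ∀ {v} → carrier v → level v ≤ m
            large    : ∀ {k} → k ≤ m → ¬ Small s (fibre carrier level k)
            complete : ∀ {u v} → carrier u → carrier v → level v ≡ suc (level u) → u ⟶ v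

        record Extension (m s : ℕ) (A B : Pred (Fin n) 0ℓ) : Set₁ where
          field
            extended : Chain (suc m) s (A ⋃ B)
          open Chain extended public
          field
            inA : ∀ {v} → carrier v → level v ≤ m → A v
            inB : ∀ {v} → carrier v → level v ≡ suc m → B v

        extend : ∀ {m} → Chain m s A → ¬ Small s B → Complete A B → ¬ ¬ Extension m s A B
        extend {s} {A} {B} {m} C ¬smB AB κ = do
          A? ← ¬¬-all n λ v → em (C.carrier v)
          let f : Fin n → ℕ
              f v = pick (A? v) (C.level v) (suc m)
              f-A : ∀ {v} → C.carrier v → f v ≡ C.level v
              f-A {v} = pick-yes (A? v)
              f-B : ∀ {v} → B v → f v ≡ suc m
              f-B {v} y = pick-no (A? v) λ x → irrefl (AB (C.within x) y)
              f≤m : ∀ {v} → C.carrier v → f v ≤ m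
              f≤m x = ≤-trans (≤-reflexive (f-A x)) (C.level-≤ x)
          κ record
            { extended = record
              { carrier  = C.carrier ⋃ B
              ; level    = f
              ; within   = λ { (inj₁ x) → inj₁ (C.within x) ; (inj₂ y) → inj₂ y }
              ; level-≤  = λ { (inj₁ x) → m≤n⇒m≤1+n (f≤m x) ; (inj₂ y) → ≤-reflexive (f-B y) }
              ; large    = λ {k} k≤1+m → case m≤n⇒m<n∨m≡n k≤1+m of λ
                  { (inj₁ k<1+m) → C.large (s≤s⁻¹ k<1+m) ∘ small-⊆ λ (x , eq) → inj₁ x , trans (f-A x) eq
                  ; (inj₂ refl)  → ¬smB ∘ small-⊆ λ y → inj₂ y , f-B y
                  }
              ; complete = λ
                  { (inj₁ x) (inj₁ y) eq → C.complete x y (trans (sym (f-A y)) (trans eq (cong suc (f-A x))))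
                  ; (inj₁ x) (inj₂ y) eq → AB (C.within x) y
                  ; (inj₂ x) (inj₁ y) eq →
                      contradiction eq (<⇒≢ (s≤s (≤-trans (f≤m y) (≤-trans (n≤1+n m) (≤-reflexive (sym (f-B x)))))))
                  ; (inj₂ x) (inj₂ y) eq → contradiction (trans (sym (f-B y)) (trans eq (cong suc (f-B x)))) (<⇒≢ ≤-refl)
                  }
              }
            ; inA = λ { (inj₁ x) _ → C.within x ; (inj₂ y) f≤m → contradiction (subst (_≤ m) (f-B y) f≤m) 1+n≰n }
            ; inB = λ { (inj₁ x) eq → contradiction (subst (_≤ m) eq (f≤m x)) 1+n≰n ; (inj₂ y) _ → y }
            }
          where module C = Chain C

        -- A chain is built inside the first set of a complete pair, and the second set becomes its
        -- last level.
        chain : ∀ m s → Z ⊆ Y → ¬ Small (chainThreshold m s) Z → ¬ ¬ Chain m s Z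
        chain {Z} zero s Z⊆Y ¬sm κ = κ record
          { carrier = Z ; level = λ _ → 0 ; within = id ; level-≤ = λ _ → z≤n
          ; large = λ { z≤n → ¬sm ∘ small-⊆ (_, refl) } ; complete = λ _ _ () }
        chain (suc m) s Z⊆Y ¬sm κ = do
          (A , B , A⊆Z , B⊆Z , AB , ¬smA , ¬smB) ← complete-pair Z⊆Y ¬sm
          C ← chain m s (Z⊆Y ∘ A⊆Z) (¬smA ∘ small-≤ (m≤m+n _ s))
          E ← extend C (¬smB ∘ small-≤ (m≤n+m s (chainThreshold m s))) AB
          let open Extension E
          κ record
            { carrier = carrier ; level = level ; within = λ x → [ A⊆Z , B⊆Z ]′ (within x)
            ; level-≤ = level-≤ ; large = large ; complete = complete }

        -- A chain from A to B closes up through v₀ to a blow-up of a long directed cycle,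
        -- in which the arcs from A to B are available for the classes acyclic in T.
        module Triangle {v₀ : Fin n} (yv₀ : Y v₀) (A⊆Y : A ⊆ Y) (B⊆Y : B ⊆ Y)
                        (v₀A : ∀ {u} → A u → v₀ ⟶ u) (Bv₀ : ∀ {u} → B u → u ⟶ v₀) (AB : Complete A B)
                        (extension : Extension ℓ (richThreshold 0) A B) where
          open Extension extension

          -- The chain occupies the levels `0` to `ℓ + 1`. Placed just above, `v₀` is entered from
          -- the last level by climbs and left to the first by drops.
          top : ℕ
          top = suc (suc ℓ)

          lev : Fin n → ℕ
          lev v = pick (v ≟ v₀) top (level v)

          lev-v₀ : lev v₀ ≡ top
          lev-v₀ = pick-yes (v₀ ≟ v₀) refl

          lev-carrier : ∀ {v} → carrier v → lev v ≡ level v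
          lev-carrier {v} x = pick-no (v ≟ v₀) λ { refl →
            [ (λ a → irrefl (v₀A a)) , (λ b → irrefl (Bv₀ b)) ]′ (within x) }

          W : Pred (Fin n) 0ℓ
          W v = v ≡ v₀ ⊎ carrier v

          W⊆Y : W ⊆ Y
          W⊆Y (inj₁ refl) = yv₀
          W⊆Y (inj₂ x)    = [ A⊆Y , B⊆Y ]′ (within x)

          inCarrier : ∀ {k} → k < top → fibre W lev k ⊆ fibre carrier level k
          inCarrier k< (inj₁ refl , eq) = contradiction (trans (sym eq) lev-v₀) (<⇒≢ k<)
          inCarrier k< (inj₂ x    , eq) = x , trans (sym (lev-carrier x)) eq

          fromCarrier : ∀ {k} → fibre carrier level k ⊆ fibre W lev k
          fromCarrier (x , eq) = inj₂ x , trans (lev-carrier x) eq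

          firstA : fibre W lev 0 ⊆ A
          firstA z = let x , eq = inCarrier z<s z in inA x (≤-trans (≤-reflexive eq) z≤n)

          lastB : fibre W lev (suc ℓ) ⊆ B
          lastB z = let x , eq = inCarrier ≤-refl z in inB x eq

          module _ (cover : LevelCover W lev top 0) where
            open LevelCover cover

            climb : ∀ i → class i v₀ → ∀ k → k ≤ suc ℓ →
                    ¬ ¬ (∃[ x ] class i x × fibre W lev k x × Walk (levelArcs lev ↾ (class i ∩ W)) (suc k) v₀ x)
            climb i c zero    _  κ = do
              (x , cx , z , eq) ← nonempty (dense {0} z<s i)
              let drop : lev x + ℓ ≤ lev v₀
                  drop = ≤-trans (≤-reflexive (cong (_+ ℓ) eq)) (≤-trans (m≤n+m ℓ 2) (≤-reflexive (sym lev-v₀)))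
              κ (x , cx , (z , eq) , ((c , inj₁ refl) , (cx , z) , v₀A (firstA (z , eq)) , inj₂ drop) ∷ [])
            climb i c (suc k) k< κ = do
              (x , cx , (z , eq) , w) ← climb i c k (<⇒≤ k<)
              (y , cy , z′ , eq′) ← nonempty (dense {suc k} (s≤s k<) i)
              let px , lx = inCarrier (m≤n⇒m≤1+n k<) (z , eq)
                  py , ly = inCarrier (s≤s k<) (z′ , eq′)
                  arc : levelArcs lev x y
                  arc = complete px py (trans ly (cong suc (sym lx))) , inj₁ (trans eq′ (cong suc (sym eq)))
              κ (y , cy , (z′ , eq′) , w ∷ʳ ((cx , z) , (cy , z′) , arc))

            impossible : ⊥
            impossible = em (∃[ i ] class i v₀) λ
              -- A class containing `v₀` meets every level of the chain, and consecutive levels are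
              -- complete, so it contains a closed walk.
              { (yes (i , c)) → do
                  (x , cx , (z , eq) , w) ← climb i c (suc ℓ) ≤-refl
                  acyclic i (w ∷ʳ ((cx , z) , (c , inj₁ refl) , Bv₀ (lastB (z , eq)) ,
                                   inj₁ (trans lev-v₀ (cong suc (sym eq)))))
              -- Otherwise `v₀` has a colour. This colour occurs on the first and on the last level,
              -- which gives a directed triangle of `T` in that colour.
              ; (no ∉) → do
                  let y₀ = yv₀ , λ i c → ∉ (i , c)
                  (i , c) ← Colouring.covers colouring y₀
                  (p , zp , yp , cp) ← present {0} z<s i
                  (q , zq , yq , cq) ← present {suc ℓ} ≤-refl i
                  Colouring.acyclic colouring i
                    ( ((c  , y₀) , (cp , yp) , v₀A (firstA zp))
                    ∷ ((cp , yp) , (cq , yq) , AB (firstA zp) (lastB zq))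
                    ∷ ((cq , yq) , (c  , y₀) , Bv₀ (lastB zq))
                    ∷ [])
              }

        no-triangle : ∀ {v} → Y v → A ⊆ Y → B ⊆ Y → (∀ {u} → A u → v ⟶ u) → (∀ {u} → B u → u ⟶ v) →
                      Complete A B → ¬ Small triangleThreshold A → ¬ ¬ Small triangleThreshold B
        no-triangle yv A⊆Y B⊆Y vA Bv AB ¬smA ¬smB = do
          C ← chain ℓ (richThreshold 0) A⊆Y (¬smA ∘ small-≤ (m≤m+n _ _))
          E ← extend C (¬smB ∘ small-≤ (m≤n+m _ (chainThreshold ℓ (richThreshold 0)))) AB
          let open Triangle yv A⊆Y B⊆Y vA Bv AB E
          cover ← levelCover 0 W⊆Y λ k< → Extension.large E (s≤s⁻¹ k<) ∘ small-⊆ fromCarrier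
          impossible cover

        -- A vertex order with small backward neighbourhoods

        between : Fin n → Fin n → Pred (Fin n) 0ℓ
        between u v x = Y x × u ⟶ x × x ⟶ v

        -- By `mutual-forward` it suffices that the two sets are forward to each other. Large parts
        -- violating this would contradict `no-triangle`, at `v` for one direction and at `u` for
        -- the other.
        between-small : ∀ {u v} → Y u → Y v → ¬ Small betweenThreshold (between u v) →
                        Small betweenThreshold (between v u)
        between-small yu yv ¬sm = small-stable λ ¬sm′ →
          mutual-forward proj₁ proj₁ (λ (_ , ux , xv) (_ , vx , xu) → asym ux xu)
            (λ A′⊆ B′⊆ BA → no-triangle′ yv (proj₁ ∘ B′⊆) (proj₁ ∘ A′⊆) (proj₁ ∘ proj₂ ∘ B′⊆) (proj₂ ∘ proj₂ ∘ A′⊆) BA)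
            (λ A′⊆ B′⊆ BA → no-triangle′ yu (proj₁ ∘ B′⊆) (proj₁ ∘ A′⊆) (proj₁ ∘ proj₂ ∘ B′⊆) (proj₂ ∘ proj₂ ∘ A′⊆) BA)
            ¬sm ¬sm′
          where
          no-triangle′ : ∀ {v} → Y v → A ⊆ Y → B ⊆ Y → (∀ {u} → A u → v ⟶ u) → (∀ {u} → B u → u ⟶ v) →
                         Complete A B → ¬ Small triangleThreshold B → ¬ ¬ Small triangleThreshold A
          no-triangle′ yv A⊆Y B⊆Y vA Bv AB ¬smB ¬smA = no-triangle yv A⊆Y B⊆Y vA Bv AB ¬smA ¬smB

        Precedes : Fin n → Fin n → Set₁
        Precedes u v = Y u × Y v × ¬ Small precedesThreshold (between u v)

        -- If the walk continues after its first step to `w`, a vertex of `between u w` lies in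
        -- `between u v`, equals `v`, or lies in `between v w`. The last set is small because by
        -- induction `between w v` is large. `precedesThreshold` leaves room for this loss, so
        -- nothing accumulates along the walk.
        precedes-between : ∀ {k u v} → Walk Precedes (suc k) u v → ¬ Small betweenThreshold (between u v)
        precedes-between (_∷_ {v = w} (yu , yw , ¬sm) []) = ¬sm ∘ small-≤ (m≤m+n _ _)
        precedes-between {u = u} {v} (_∷_ {v = w} (yu , yw , ¬sm) walk@(_ ∷ _)) sm =
          ¬sm (small-∪ sm (small-∪ (small-singleton {X = _≡ v} λ { refl refl → refl })
                                   (between-small yw (last walk) (precedes-between walk)) λ z κ → κ z)
            λ {x} (y , ux , xw) κ → em (x ≡ v) λ
              { (yes x≡v) → κ (inj₂ (inj₁ x≡v))
              ; (no x≢v)  → case total x≢v of λ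
                  { (inj₁ xv) → κ (inj₁ (y , ux , xv))
                  ; (inj₂ vx) → κ (inj₂ (inj₂ (y , vx , xw)))
                  }
              })
          where
          last : ∀ {k u v} → Walk Precedes (suc k) u v → Y v
          last ((_ , y , _) ∷ [])  = y
          last (_ ∷ w@(_ ∷ _))     = last w

        precedes-acyclic : NoClosedWalk Precedes
        precedes-acyclic w = precedes-between w (small-∅ λ (_ , vx , xv) → asym vx xv)

        module Ordered {pos : Fin n → ℕ} (precedes-< : ∀ {u v} → Precedes u v → pos u < pos v) where

          between-small-≤ : ∀ {u v} → Y u → Y v → pos v ≤ pos u → Small precedesThreshold (between u v)
          between-small-≤ yu yv v≤u = small-stable λ ¬sm → <⇒≱ (precedes-< (yu , yv , ¬sm)) v≤u

          -- For `u ⟶ x` inside this set, `x` lies in `between u v`, which is small since `v` does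
          -- not come after `u`. So out-neighbourhoods within the set are small.
          back-in : ∀ {v} → Y v → Small backThreshold (λ u → Y u × u ⟶ v × pos v ≤ pos u)
          back-in yv = small-if-small-out proj₁ λ (yu , _ , v≤u) →
            small-⊆ (λ ((yx , xv , _) , ux) → yx , ux , xv) (between-small-≤ yu yv v≤u)

          back-out : ∀ {v} → Y v → Small backThreshold (λ u → Y u × v ⟶ u × pos u ≤ pos v)
          back-out yv = small-if-small-in proj₁ λ (yu , _ , u≤v) →
            small-⊆ (λ ((yx , vx , _) , xu) → yx , vx , xu) (between-small-≤ yv yu u≤v)

          -- `pos` need not be injective; arcs inside a fibre count as backward, so `back-in`
          -- applies to them.
          fibre-small : ∀ j → Small fibreThreshold (fibre Y pos j)
          fibre-small j = small-if-small-in proj₁ λ (yv , eq) →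
            small-⊆ (λ ((yu , eq′) , uv) → yu , uv , ≤-reflexive (trans eq (sym eq′))) (back-in yv)

          -- Blocks of the order as levels

          module _ (grouping : Grouping Y pos blockThreshold (blockThreshold + fibreThreshold)) where
            open Grouping grouping

            Grouped : Pred (Fin n) 0ℓ
            Grouped v = Y v × block v < count

            -- The `ℓ` turns a back arc over this many blocks into a level arc; the 2 leaves at
            -- least one block strictly between its ends.
            width : ℕ
            width = suc (suc ℓ)

            module _ (cover : LevelCover Grouped block count (backThreshold + backThreshold)) where
              open LevelCover cover

              -- A class meets every block in a large set, so an arc going back over many
              -- blocks would be closed to a directed cycle by a path through the blocks in between.
              no-long-back-arc : ∀ i {u v} → (class i ∩ Grouped) u → (class i ∩ Grouped) v →
                                 block u + width ≤ block v → ¬ (v ⟶ u)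
              no-long-back-arc i {u} {v} cu@(_ , yu , _) cv@(_ , yv , v<count) u≪v vu = do
                (x , (cx , gx , eq) , (y , (cy , eq′ , yv′) , w) , ux) ← start
                acyclic i {suc (suc N)} ((cv , cu , vu , inj₂ (≤-trans (+-monoʳ-≤ (block u) (m≤n+m ℓ 2)) u≪v))
                  ∷ (cu , (cx , gx) , ux , inj₁ (trans eq (+-identityʳ _)))
                  ∷ (w ∷ʳ (cy , cv , yv′ , inj₁ (trans (sym eq′) (+-comm _ 1)))))
                where
                C : Pred (Fin n) 0ℓ
                C = class i ∩ Grouped

                R : Rel (Fin n) 0ℓ
                R = levelArcs block ↾ C

                N : ℕ
                N = block v ∸ suc (suc (block u))

                u+N : suc (suc (block u)) + N ≡ block v
                u+N = m+[n∸m]≡n (≤-trans (≤-reflexive (+-comm 2 (block u)))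
                  (≤-trans (+-monoʳ-≤ (block u) (s≤s (s≤s z≤n))) u≪v))

                D : ℕ → Pred (Fin n) 0ℓ
                D t = class i ∩ fibre Grouped block (suc (block u) + t)

                inRange : ∀ t → t ≤ N → suc (block u) + t < block v
                inRange t t≤N = ≤-trans (s≤s (+-monoʳ-≤ (suc (block u)) t≤N)) (≤-reflexive u+N)

                K : Pred (Fin n) 0ℓ
                K y = C y × block y + 1 ≡ block v × y ⟶ v

                D-large : ∀ t → t ≤ N → ¬ Small (backThreshold + backThreshold) (D t)
                D-large t t≤N = dense (<-trans (inRange t t≤N) v<count) i

                climbs : ∀ {t x y} → D t x → D (suc t) y → block y ≡ suc (block x)
                climbs {t} (_ , _ , eq) (_ , _ , eq′) = trans eq′ (trans (+-suc (suc (block u)) t) (cong suc (sym eq)))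

                -- `D (suc t)` lies in a later block, so vertices of it that dominate a vertex of
                -- `D t` belong to the small backward in-neighbourhood of that vertex.
                forward : ∀ t → t < N → Forward backThreshold (D t) (D (suc t))
                forward t _ {A} {B} A⊆D B⊆D BA ¬smA ¬smB = do
                  (a , x) ← nonempty ¬smA
                  let dx = A⊆D x
                  ¬smB (small-⊆ (λ y → proj₁ (proj₁ (proj₂ (B⊆D y))) , BA y x ,
                                       <⇒≤ (monotone (≤-reflexive (sym (climbs {t} dx (B⊆D y))))))
                                (back-in (proj₁ (proj₁ (proj₂ dx)))))

                target : Small backThreshold (λ x → D N x × ¬ K x)
                target = small-⊆ (λ {x} (d@(c , g@(yx , _) , eq) , ¬k) →
                    let x<v : block x < block v
                        x<v = ≤-trans (s≤s (≤-reflexive eq)) (≤-reflexive u+N)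
                    in case total {x} {v} (λ { refl → <-irrefl refl x<v }) of λ
                      { (inj₁ xv) → contradiction ((c , g) , trans (cong (_+ 1) eq) (trans (+-comm _ 1) u+N) , xv) ¬k
                      ; (inj₂ vx) → yx , vx , <⇒≤ (monotone x<v)
                      })
                  (back-out yv)

                unreachable : Small backThreshold (λ x → D 0 x × ¬ (∃[ y ] K y × Walk R N x y))
                unreachable = reach D N K forward
                  (λ t _ dx dy → <⇒≢ ≤-refl (climbs {t} dx dy))
                  (λ t _ dx@(c , g , _) dy@(c′ , g′ , _) xy → (c , g) , (c′ , g′) , xy , inj₁ (climbs {t} dx dy))
                  D-large target N 0 refl

                -- `D 0` is too large to consist only of vertices that do not reach `K` and of
                -- backward in-neighbours of `u`.
                start : ¬ ¬ (∃[ x ] D 0 x × (∃[ y ] K y × Walk R N x y) × u ⟶ x)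
                start κ = D-large 0 z≤n (small-∪ unreachable (back-in yu) λ {x} d@(c , (yx , _) , eq) κ′ →
                  em (∃[ y ] K y × Walk R N x y) λ
                    { (no ¬r) → κ′ (inj₁ (d , ¬r))
                    ; (yes r) →
                        let u<x : block u < block x
                            u<x = ≤-reflexive (trans (sym (+-identityʳ _)) (sym eq))
                        in case total {x} {u} (λ { refl → <-irrefl refl u<x }) of λ
                          { (inj₁ xu) → κ′ (inj₂ (yx , xu , <⇒≤ (monotone u<x)))
                          ; (inj₂ ux) → κ (x , d , r , ux)
                          }
                    })

              -- Different blocks with the same residue modulo `width` are at least `width` apart,
              -- so within the class all arcs between them go forward. `small-lex` then reuses the
              -- colours of one block for the whole residue.
              class-small : ∀ i → Small (width * (blockThreshold + fibreThreshold)) (class i ∩ Grouped)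
              class-small i = small-⋃ width {λ r → fibre (class i ∩ Grouped) (λ v → block v % width) r}
                (λ r _ → small-lex count block (λ ((_ , _ , v<) , _) → v<)
                  (λ k k<count → small-⊆ (λ { (((_ , y , _) , _) , eq) → y , eq }) (small k<count))
                  λ (u , eq) (v , eq′) uv → ≮⇒≥ λ v<u →
                    no-long-back-arc i v u (residue v<u (trans eq′ (sym eq))) uv)
                λ {v} x κ → κ (block v % width , m%n<n (block v) width , x , refl)
                where
                residue : ∀ {x y} → x < y → x % width ≡ y % width → x + width ≤ y
                residue {x} {y} x<y eq with m≤n⇒∃[o]m+o≡n (quotient-< x<y)
                  where
                  quotient-< : x < y → x / width < y / width
                  quotient-< x<y = ≰⇒> λ q≤ → <⇒≱ x<y (subst₂ _≤_
                    (sym (m≡m%n+[m/n]*n y width)) (sym (m≡m%n+[m/n]*n x width))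
                    (+-mono-≤ (≤-reflexive (sym eq)) (*-monoˡ-≤ width q≤)))
                ... | o , q = subst₂ _≤_ (sym lhs) (sym (m≡m%n+[m/n]*n y width))
                    (+-mono-≤ (≤-reflexive eq) (*-monoˡ-≤ width (≤-trans (m≤m+n _ o) (≤-reflexive q))))
                  where
                  lhs : x + width ≡ x % width + suc (x / width) * width
                  lhs = trans (cong (_+ width) (m≡m%n+[m/n]*n x width))
                          (trans (+-assoc (x % width) _ width) (cong (x % width +_) (+-comm _ width)))

              Y-small : Small bound Y
              Y-small = small-∪ last
                (small-∪ {X = λ v → ∃[ i ] (class i ∩ Grouped) v} {Z = Grouped}
                  (small-⋃ (suc a) {λ k v → Σ[ k< ∈ k < suc a ] (class (fromℕ< k<) ∩ Grouped) v}
                    (λ k k< → small-⊆ (λ (_ , x) → x) (class-small (fromℕ< k<)))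
                    λ { (i , x) κ → κ (toℕ i , toℕ<n i , toℕ<n i ,
                          subst (λ j → (class j ∩ Grouped) _) (sym (fromℕ<-toℕ i (toℕ<n i))) x) })
                  (λ κ → κ colouring)
                  λ {v} g@(y , _) κ → em (∃[ i ] class i v) λ
                    { (yes (i , c)) → κ (inj₁ (i , c , g))
                    ; (no ∉)        → κ (inj₂ (y , λ i c → ∉ (i , c)))
                    })
                λ {v} y κ → case m≤n⇒m<n∨m≡n (bounded v) of λ
                  { (inj₁ v<) → κ (inj₂ (y , v<))
                  ; (inj₂ eq) → κ (inj₁ (y , eq))
                  }

        small : Small bound Y
        small κ = do
          (pos , pos≤n , mono) ← rankFunction precedes-acyclic
          let open Ordered mono
          G ← grouping blockThreshold pos≤n fibre-small
          cover ← levelCover {lev = Grouping.block G} (backThreshold + backThreshold) proj₁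
            λ k< → Grouping.large G k< ∘ small-⊆ (λ (y , eq) → (y , subst (_< _) (sym eq) k<) , eq)
          Y-small G cover κ

    bounded-step : Bounded (suc a) b
    bounded-step = bound , λ T Y coverable → On.small T coverable

  -- The hypothesis for `a` covers every second parameter because making classes dense trades one
  -- class for `t` more colours.
  bounded : ∀ a b → Bounded a b
  bounded zero    b       = bounded-zero b
  bounded (suc a) zero    = Step.bounded-step a zero (bounded a) (bounded-zero 0)
  bounded (suc a) (suc b) = Step.bounded-step a (suc b) (bounded a) (bounded (suc a) b)

-- Transfer to digraphs and their dichromatic numbers

directedCycle⇒closedWalk : (D : Digraph n) → HasDirectedCycle D m →
                           ∃[ k ] ∃[ v ] m ≡ suc k × Walk (Digraph._⟶_ D) (suc k) v v
directedCycle⇒closedWalk {m = zero}  D (_ , cyc) = contradiction cyc (size≢0 D)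
directedCycle⇒closedWalk {m = suc k} D (c , cyc) =
  k , c (0 mod suc k) , refl ,
  subst (Walk _⟶_ (suc k) _) (cong c (toℕ-injective (trans (toℕ-mod (suc k)) (n%n≡0 (suc k)))))
    (tabulateWalk (λ i → c (i mod suc k)) (suc k) 0 λ i _ i<1+k →
      subst (λ j → c (i mod suc k) ⟶ c (suc j mod suc k))
        (trans (toℕ-mod i) (m<n⇒m%n≡m i<1+k)) (IsDirectedCycle.consecutive cyc (i mod suc k)))
  where
  open Digraph D using (_⟶_)
  toℕ-mod : ∀ i → toℕ (i mod suc k) ≡ i % suc k
  toℕ-mod i = toℕ-fromℕ< (m%n<n i (suc k))

module _ (D : Digraph n) where
  open Digraph D using (_⟶_)

  private
    simple⇒directedCycle : ∀ {v} (w : Walk _⟶_ (suc k) v v) →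
                           (∀ i j → toℕ {suc k} i < toℕ {suc k} j → at w (toℕ i) ≢ at w (toℕ j)) →
                           IsDirectedCycle D (at w ∘ toℕ {suc k})
    simple⇒directedCycle {k = k} {v} w simple = record
      { distinct    = λ {i} {j} eq → case <-cmp (toℕ i) (toℕ j) of λ
          { (tri< i<j _ _) → contradiction eq (simple i j i<j)
          ; (tri≈ _ i≡j _) → toℕ-injective i≡j
          ; (tri> _ _ j<i) → contradiction (sym eq) (simple j i j<i)
          }
      ; consecutive = λ i → subst (at w (toℕ i) ⟶_) (wrap i (m≤n⇒m<n∨m≡n (toℕ<n i))) (step w (toℕ<n i))
      }
      where
      wrap : ∀ i → suc (toℕ i) < suc k ⊎ suc (toℕ i) ≡ suc k →
             at w (suc (toℕ i)) ≡ at w (toℕ (suc (toℕ {suc k} i) mod suc k))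
      wrap i (inj₁ i<k) = cong (at w) (sym (trans (toℕ-fromℕ< (m%n<n (suc (toℕ i)) (suc k))) (m<n⇒m%n≡m i<k)))
      wrap i (inj₂ i≡k) = trans (trans (cong (at w) i≡k) (at-end w)) (trans (sym (at-zero w)) (cong (at w)
        (sym (trans (toℕ-fromℕ< (m%n<n (suc (toℕ i)) (suc k))) (trans (cong (_% suc k) i≡k) (n%n≡0 (suc k)))))))

    -- `N` bounds the recursion. A repeated vertex cuts out a shorter closed walk; without one the
    -- walk is a directed cycle.
    shorten : ∀ N {k v} → k < N → Walk _⟶_ (suc k) v v → ∃[ m ] HasDirectedCycle D m
    shorten (suc N) {k} k<N w
      with any? {n = suc k} (λ i → any? {n = suc k} (λ j →
             (toℕ i ℕ.<? toℕ j) ×-dec (at w (toℕ i) ≟ at w (toℕ j))))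
    ... | yes (i , j , i<j , eq) = shorten N
            (<-≤-trans (shorter i<j) (≤-trans (s≤s⁻¹ (toℕ<n j)) (s≤s⁻¹ k<N)))
            (closedSubwalk w i<j (<⇒≤ (toℕ<n j)) eq)
      where
      shorter : ∀ {a b} → a < b → b ∸ suc a < b
      shorter {a} (s≤s {n = b} _) = s≤s (m∸n≤m b a)
    ... | no ¬repeated = suc k , _ , simple⇒directedCycle w λ i j i<j eq → ¬repeated (i , j , i<j , eq)

  closedWalk⇒directedCycle : ∀ {v} → Walk _⟶_ (suc k) v v → ∃[ m ] HasDirectedCycle D m
  closedWalk⇒directedCycle w = shorten _ ≤-refl w

∈-tabulate⁺ : ∀ {f : Fin n → Bool} {v} → f v ≡ true → v ∈ tabulate f
∈-tabulate⁺ {f = f} {v} eq = lookup⇒[]= v (tabulate f) (trans (lookup∘tabulate f v) eq)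

∈-tabulate⁻ : ∀ {f : Fin n → Bool} {v} → v ∈ tabulate f → f v ≡ true
∈-tabulate⁻ {f = f} {v} v∈ = trans (sym (lookup∘tabulate f v)) ([]=⇒lookup v∈)

module _ {T : Digraph n} (isTournament : IsTournament T) where
  open Digraph T using (_⟶_; _⟶?_; ends; loopless)

  Vertex : Pred (Fin n) 0ℓ
  Vertex v = v ∈ V T

  private
    Inside : Rel (Fin n) 0ℓ
    Inside u v = Vertex u × Vertex v

  -- Arcs are added so that no vertex set has to be carried along; only vertices of T matter.
  completion : Tournament n
  completion = record
    { _⟶_   = λ u v → u ⟶ v ⊎ ¬ Inside u v × toℕ u < toℕ v
    ; asym  = λ
        { (inj₁ uv)         (inj₁ vu)         → asym uv vu
        ; (inj₁ uv)         (inj₂ (¬in , _))  → ¬in (proj₂ (ends uv) , proj₁ (ends uv))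
        ; (inj₂ (¬in , _))  (inj₁ vu)         → ¬in (proj₂ (ends vu) , proj₁ (ends vu))
        ; (inj₂ (_ , u<v))  (inj₂ (_ , v<u))  → <-asym u<v v<u
        }
    ; total = total
    }
    where
    open IsTournament isTournament
    asym : ∀ {u v} → u ⟶ v → ¬ (v ⟶ u)
    asym uv vu with exactlyOne (proj₁ (ends uv)) (proj₂ (ends uv)) (λ { refl → loopless uv })
    ... | inj₁ (_ , ¬vu) = ¬vu vu
    ... | inj₂ (¬uv , _) = ¬uv uv
    total : ∀ {u v} → u ≢ v → (u ⟶ v ⊎ ¬ Inside u v × toℕ u < toℕ v) ⊎ (v ⟶ u ⊎ ¬ Inside v u × toℕ v < toℕ u)
    total {u} {v} u≢v with (u ∈? V T) ×-dec (v ∈? V T)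
    ... | no ¬in with <-cmp (toℕ u) (toℕ v)
    ...   | tri< u<v _ _ = inj₁ (inj₂ (¬in , u<v))
    ...   | tri≈ _ u≡v _ = contradiction (toℕ-injective u≡v) u≢v
    ...   | tri> _ _ v<u = inj₂ (inj₂ ((λ (v∈ , u∈) → ¬in (u∈ , v∈)) , v<u))
    total {u} {v} u≢v | yes (u∈ , v∈) with exactlyOne u∈ v∈ u≢v
    ... | inj₁ (uv , _) = inj₁ (inj₁ uv)
    ... | inj₂ (_ , vu) = inj₂ (inj₁ vu)

  open Smallness completion using (Colouring; Small)

  -- The inequality is decidable, so a colouring under double negation suffices. Selecting one
  -- colour for each vertex turns the cover into a partition.
  small⇒χ≤ : ∀ {F} → Small F Vertex → χ⃗ T ≤ F
  small⇒χ≤ {F} sm = decidable-stable (χ⃗ T ℕ.≤? F) λ ¬≤ → do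
    c ← sm
    let open Colouring c
    colour ← ¬¬-all n {P = Coloured class} λ v κ → case v ∈? V T of λ
      { (yes v∈) → covers v∈ λ i → κ (inj₁ (v∈ , i))
      ; (no v∉)  → κ (inj₂ v∉)
      }
    ¬≤ (proj₂ (proj₂ (dichromaticNumber T)) F (dicolouring c colour))
    where
    Coloured : (Fin F → Pred (Fin n) 0ℓ) → Fin n → Set
    Coloured class v = (Vertex v × ∃[ i ] class i v) ⊎ ¬ Vertex v

    module _ (c : Colouring F Vertex) (colour : ∀ v → Coloured (Colouring.class c) v) where
      open Colouring c

      has : ∀ {v} → Coloured class v → Fin F → Bool
      has (inj₁ (_ , j , _)) i = does (j ≟ i)
      has (inj₂ _)           i = false

      has⁻ : ∀ {v i} (x : Coloured class v) → has x i ≡ true → Vertex v × class i v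
      has⁻ {i = i} (inj₁ (v∈ , j , cj)) eq with j ≟ i
      ... | yes refl = v∈ , cj

      P : Fin F → Subset n
      P i = tabulate λ v → has (colour v) i

      P⁻ : ∀ {i v} → v ∈ P i → Vertex v × class i v
      P⁻ {v = v} v∈ = has⁻ (colour v) (∈-tabulate⁻ v∈)

      covered : ∀ {v} → Vertex v → ∃! _≡_ λ i → v ∈ P i
      covered {v} v∈ with colour v in eq
      ... | inj₂ v∉ = contradiction v∈ v∉
      ... | inj₁ (v∈′ , i , ci) = i , ∈-tabulate⁺ (trans (cong (λ x → has x i) eq) (dec-true (i ≟ i) refl)) , unique
        where
        unique : ∀ {j} → v ∈ P j → i ≡ j
        unique {j} v∈j with i ≟ j | trans (sym (cong (λ x → has x j) eq)) (∈-tabulate⁻ v∈j)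
        ... | yes i≡j | _ = i≡j

      dicolouring : Dicolourable T F
      dicolouring = P , record
        { parts   = λ i → proj₁ ∘ P⁻
        ; covers  = covered
        ; acyclic = λ i m cyc → let _ , _ , _ , w = directedCycle⇒closedWalk (induced T (P i)) cyc in
            acyclic i (mapWalk (λ ((u∈ , v∈) , uv) → swap (P⁻ u∈) , swap (P⁻ v∈) , inj₁ uv) w)
        }

  -- Boolean matrices leave finitely many candidates, so that a search can turn double-negated
  -- existence into a witness.
  subdigraph : Vec (Vec Bool n) n → Digraph n
  subdigraph M = record
    { V        = V T
    ; _⟶_      = λ u v → u ⟶ v × lookup (lookup M u) v ≡ true
    ; _⟶?_     = λ u v → (u ⟶? v) ×-dec (lookup (lookup M u) v Bool.≟ true)
    ; ends     = ends ∘ proj₁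
    ; loopless = loopless ∘ proj₁
    }

  module _ {ℓ : ℕ} where
    open LongGirth ℓ
    open Covers completion using (Girthy; Cover; ↾-girthy; small-∅)

    module _ {R : Rel (Fin n) 0ℓ} (girthy : Girthy R) (M : Vec (Vec Bool n) n)
             (sound    : ∀ {u v} → lookup (lookup M u) v ≡ true → R u v)
             (complete : ∀ {u v} → R u v → lookup (lookup M u) v ≡ true) where
      open Girthy girthy

      private
        H : Digraph n
        H = subdigraph M

      ℓ<digirth : ∀ {g} → IsDigirth H g → [ ℓ ] <⁺ g
      ℓ<digirth {⊤⁺}    _         = [ ℓ ]<⊤⁺
      ℓ<digirth {[ g ]} (cyc , _) with directedCycle⇒closedWalk H cyc
      ... | k , v , refl , w = [ s≤s (girth (mapWalk (sound ∘ proj₂) w)) ]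

      -- The `l` parts are padded with empty classes up to `k`. Arcs of `R` between vertices of `T`
      -- are arcs of `H`, since every arc added in `completion` has an end outside `T`.
      dicolourable⇒cover : ∀ {k l} → l ≤ k → Dicolourable H l → Cover k 0 R Vertex
      dicolourable⇒cover {k} {l} l≤k (P , part) = record
        { class   = class
        ; acyclic = λ { i w@((((i<l , _) , _) , _) ∷ _) →
            let m , cyc = closedWalk⇒directedCycle (induced H (P (fromℕ< i<l))) (mapWalk (arc {i} i<l) w)
            in  acyclic (fromℕ< i<l) m cyc }
        ; rest    = small-∅ λ {v} (v∈ , ∉) →
            let i , v∈Pi , _ = covers v∈
                i<k = <-≤-trans (toℕ<n i) l≤k
                i<l = subst (_< l) (sym (toℕ-fromℕ< i<k)) (toℕ<n i)
            in  ∉ (fromℕ< i<k) (i<l , subst (λ j → v ∈ P j)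
                  (toℕ-injective (sym (trans (toℕ-fromℕ< i<l) (toℕ-fromℕ< i<k)))) v∈Pi)
        }
        where
        open IsAcyclicPartition part
        class : Fin k → Pred (Fin n) 0ℓ
        class i v = Σ[ i<l ∈ toℕ i < l ] v ∈ P (fromℕ< i<l)
        arc : ∀ {i : Fin k} (i<l : toℕ i < l) {u v} → (R ↾ (class i ∩ Vertex)) u v →
              Digraph._⟶_ (induced H (P (fromℕ< i<l))) u v
        arc _ (((_ , u∈P) , u∈) , ((_ , v∈P) , v∈) , r) with arcs r
        ... | inj₁ uv        = (u∈P , v∈P) , uv , complete r
        ... | inj₂ (¬in , _) = contradiction (u∈ , v∈) ¬in

    -- Beyond the bound, some relation of large digirth has no cover by `k` classes and no colours;
    -- its matrix, once the relation is decided, gives `H`.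
    exists-subdigraph : ∀ {k} → suc (proj₁ (bounded k 0)) ≤ χ⃗ T →
                        Σ[ H ∈ Digraph n ] (H ⊑ T × k < χ⃗ H × [ ℓ ] <⁺ girth⃗ H)
    exists-subdigraph {k} F<χ =
      let M , k<χ , ℓ<g = decidable-stable good? exists in
      subdigraph M , record { vertices = id ; arcs = proj₁ } , k<χ , ℓ<g
      where
      Good : Vec (Vec Bool n) n → Set
      Good M = k < χ⃗ (subdigraph M) × [ ℓ ] <⁺ girth⃗ (subdigraph M)

      anyBool? : {P : Pred Bool 0ℓ} → Decidable P → Dec (∃ P)
      anyBool? P? with P? true | P? false
      ... | yes p | _     = yes (true , p)
      ... | no _  | yes p = yes (false , p)
      ... | no ¬p | no ¬q = no λ { (true , p) → ¬p p ; (false , q) → ¬q q }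

      good? : Dec (∃ Good)
      good? = anyVec? (anyVec? anyBool? n) n λ M →
        (k ℕ.<? χ⃗ (subdigraph M)) ×-dec <⁺-dec ℕ._<?_ [ ℓ ] (girth⃗ (subdigraph M))

      exists : ¬ ¬ ∃ Good
      exists κ = do
        (R , girthy , ¬cover) ← Blocks.uncoverable completion (bounded k 0) λ sm → <⇒≱ F<χ (small⇒χ≤ sm)
        R? ← ¬¬-all n λ u → ¬¬-all n λ v → em (R u v)
        let M : Vec (Vec Bool n) n
            M = tabulate λ u → tabulate λ v → does (R? u v)
            entry : ∀ u v → lookup (lookup M u) v ≡ does (R? u v)
            entry = λ u v → trans (cong (λ row → lookup row v) (lookup∘tabulate _ u)) (lookup∘tabulate _ v)
            sound : ∀ {u v} → lookup (lookup M u) v ≡ true → R u v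
            sound = λ {u} {v} eq → does-true (R? u v) (trans (sym (entry u v)) eq)
            complete : ∀ {u v} → R u v → lookup (lookup M u) v ≡ true
            complete = λ {u} {v} r → trans (entry u v) (dec-true (R? u v) r)
            H = subdigraph M
        κ (M , ≰⇒> (λ χ≤k → ¬cover
               (dicolourable⇒cover girthy M sound complete χ≤k (proj₁ (proj₂ (dichromaticNumber H)))))
             , ℓ<digirth girthy M sound complete (proj₂ (digirth H)))
        where
        does-true : {A : Set} (d : Dec A) → does d ≡ true → A
        does-true (yes a) _ = a

theorem2 : ∀ (k ℓ : ℕ) → 3 ≤ ℓ →
    Σ[ f ∈ ℕ ] (∀ (n : ℕ) (T : Digraph n) → IsTournament T → f ≤ χ⃗ T →
    Σ[ H ∈ Digraph n ] (H ⊑ T × k < χ⃗ H × [ ℓ ] <⁺ girth⃗ H))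
theorem2 k ℓ _ = suc (proj₁ (bounded k 0)) , λ n T isTournament → exists-subdigraph isTournament
  where open LongGirth ℓ
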